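{- Let $P$ be a poset on $[n]$ of width two, written as $P=P_1\cup P_2$ with $P_1,P_2$ chains (totally ordered subsets) of $P$. Then \[ {\sf Poin}(P,t)=\sum_{\sigma\in\mathcal{L}(P)}t^{\operatorname{des}_{P_1,P_2}(\sigma)}, \] where $\operatorname{des}_{P_1,P_2}(\sigma)=\#\{i\in[n-1]:\sigma_i\in P_2,\ \sigma_{i+1}\in P_1,\ \sigma_i,\sigma_{i+1}\text{ incomparable in }P\}$.
   Context: Width of $P$ is the maximum size of an antichain. $\mathcal{L}(P)$ is the set of linear extensions: permutations $\sigma=[\sigma_1,\dots,\sigma_n]$ of $[n]$ such that $i<_Pj$ implies $i$ precedes $j$. $H_{ij}=\{x\in\mathbb{R}^n:x_i=x_j\}$; $\mathcal{L}$ is the set of intersections of subsets of these hyperplanes (including $V=\mathbb{R}^n$), ordered by reverse inclusion, with Möbius function $\mu$; $\mathcal{K}_P=\{x:x_i<x_j\text{ whenever }i<_Pj\}$; $\mathcal{L}^{int}(\mathcal{K}_P)=\{X\in\mathcal{L}:X\cap\mathcal{K}_P\ne\emptyset\}$; ${\sf Poin}(P,t)=\sum_kc_k(P)t^k$ with $c_k(P)=\sum_{X\in\mathcal{L}^{int}(\mathcal{K}_P),\operatorname{codim}X=k}|\mu(V,X)|$. -}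

module Defs where

open import Level using (0ℓ)
open import Data.Nat as ℕ using (ℕ; zero; suc; _+_; _∸_; _≡ᵇ_; _<ᵇ_; _≤_)
open import Data.Bool using (Bool; true; false; _∧_; _∨_; not; if_then_else_)
open import Data.Fin as Fin using (Fin; toℕ)
open import Data.Fin.Subset using (Subset; _∈_; ∣_∣)
open import Data.Fin.Subset.Properties using (_∈?_)
open import Data.List using (List; []; _∷_; [_]; map; concatMap; filterᵇ; allFin; foldr; length)
open import Data.Bool.ListAction using (all; any)
open import Data.Vec as Vec using (Vec; lookup; toList)
open import Data.Product using (Σ; ∃; _×_)
open import Data.Integer as ℤ using (ℤ)
open import Data.Rational as ℚ using (ℚ)
open import Relation.Nullary using (¬_; Dec)
open import Relation.Nullary.Decidable using (⌊_⌋)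
open import Relation.Binary using (Rel; IsDecStrictPartialOrder)
open import Relation.Binary.PropositionalEquality using (_≡_; _≢_)

record FinPoset (n : ℕ) : Set₁ where
  field
    _<P_   : Rel (Fin n) 0ℓ
    isDSPO : IsDecStrictPartialOrder _≡_ _<P_
  open IsDecStrictPartialOrder isDSPO public using () renaming (_<?_ to _<P?_)

module _ {n : ℕ} (P : FinPoset n) where
  open FinPoset P

  IsChain : Subset n → Set
  IsChain C = ∀ i j → i ∈ C → j ∈ C → i ≢ j → (i <P j) Data.Sum.⊎ (j <P i)
    where import Data.Sum

  IsAntichain : Subset n → Set
  IsAntichain A = ∀ i j → i ∈ A → j ∈ A → ¬ (i <P j)

  Width : ℕ → Set
  Width w = (Σ (Subset n) λ A → IsAntichain A × ∣ A ∣ ≡ w)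
          × (∀ A → IsAntichain A → ∣ A ∣ ≤ w)

  incomparableᵇ : Fin n → Fin n → Bool
  incomparableᵇ i j = not ⌊ i <P? j ⌋ ∧ not ⌊ j <P? i ⌋

allVecs : {A : Set} → List A → (k : ℕ) → List (Vec A k)
allVecs xs zero    = [ Vec.[] ]
allVecs xs (suc k) = concatMap (λ x → map (x Vec.∷_) (allVecs xs k)) xs

sumℤ : List ℤ → ℤ
sumℤ = foldr ℤ._+_ (ℤ.+ 0)

sumℕ : List ℕ → ℕ
sumℕ = foldr _+_ 0

module _ {n : ℕ} (P : FinPoset n) where
  open FinPoset P

  isLinExtᵇ : Vec (Fin n) n → Bool
  isLinExtᵇ σ =
    all (λ a → all (λ b →
        (⌊ a Fin.≟ b ⌋ ∨ not ⌊ lookup σ a Fin.≟ lookup σ b ⌋)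
      ∧ (not ⌊ lookup σ a <P? lookup σ b ⌋ ∨ (toℕ a <ᵇ toℕ b)))
      (allFin n)) (allFin n)

  linExts : List (Vec (Fin n) n)
  linExts = filterᵇ isLinExtᵇ (allVecs (allFin n) n)

  desL : Subset n → Subset n → List (Fin n) → ℕ
  desL P1 P2 (a ∷ b ∷ r) =
    (if ⌊ a ∈? P2 ⌋ ∧ ⌊ b ∈? P1 ⌋ ∧ incomparableᵇ P a b then 1 else 0)
    + desL P1 P2 (b ∷ r)
  desL P1 P2 _ = 0

  des : Subset n → Subset n → Vec (Fin n) n → ℕ
  des P1 P2 σ = desL P1 P2 (toList σ)

  desCoeff : Subset n → Subset n → ℕ → ℕ
  desCoeff P1 P2 k = length (filterᵇ (λ σ → des P1 P2 σ ≡ᵇ k) linExts)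

-- Intersection lattice of the braid arrangement {H_ij}.
-- A flat X ∈ 𝓛 is encoded by the equivalence relation E on [n] with
--   X = X_E = { x : x_i = x_j whenever i E j }   (intersection of the H_ij, i E j).
-- E ↦ X_E is a bijection from equivalence relations to 𝓛; V = X_id.

Mat : ℕ → Set
Mat n = Vec (Vec Bool n) n

module _ {n : ℕ} where

  rel : Mat n → Fin n → Fin n → Bool
  rel E i j = lookup (lookup E i) j

  isEquivᵇ : Mat n → Bool
  isEquivᵇ E =
      all (λ i → rel E i i) (allFin n)
    ∧ all (λ i → all (λ j → not (rel E i j) ∨ rel E j i) (allFin n)) (allFin n)
    ∧ all (λ i → all (λ j → all (λ k →
          not (rel E i j ∧ rel E j k) ∨ rel E i k) (allFin n)) (allFin n)) (allFin n)

  -- the identity relation, encoding V = ℝ^n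
  idRel : Mat n
  idRel = Vec.tabulate (λ i → Vec.tabulate (λ j → ⌊ i Fin.≟ j ⌋))

  -- X_E ≤ X_F in 𝓛 (reverse inclusion X_F ⊆ X_E)  iff  E ⊆ F
  _⊑ᵇ_ : Mat n → Mat n → Bool
  E ⊑ᵇ F = all (λ i → all (λ j → not (rel E i j) ∨ rel F i j) (allFin n)) (allFin n)

  numClasses : Mat n → ℕ
  numClasses E = length (filterᵇ
    (λ i → not (any (λ j → (toℕ j <ᵇ toℕ i) ∧ rel E j i) (allFin n)))
    (allFin n))

  codim : Mat n → ℕ
  codim E = n ∸ numClasses E

flats : (n : ℕ) → List (Mat n)
flats n = filterᵇ isEquivᵇ (allVecs (allVecs (true ∷ false ∷ []) n) n)

-- μ(V, ·) is the Möbius function of 𝓛 from its bottom V: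
-- μ(V,V) = 1 and Σ_{V ≤ Y ≤ X} μ(V,Y) = 0 for X ≠ V.
IsMöbius : {n : ℕ} → (Mat n → ℤ) → Set
IsMöbius {n} μ =
    μ idRel ≡ ℤ.+ 1
  × (∀ X → isEquivᵇ X ≡ true → X ≢ idRel →
       sumℤ (map μ (filterᵇ (λ Y → Y ⊑ᵇ X) (flats n))) ≡ ℤ.+ 0)

-- X_E ∩ 𝓚_P ≠ ∅  (points taken with rational coordinates)
MeetsCone : {n : ℕ} → FinPoset n → Mat n → Set
MeetsCone {n} P E = ∃ λ (x : Fin n → ℚ) →
    (∀ i j → rel E i j ≡ true → x i ≡ x j)
  × (∀ i j → FinPoset._<P_ P i j → x i ℚ.< x j)

poinCoeff : {n : ℕ} (P : FinPoset n) (μ : Mat n → ℤ)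
          → ((E : Mat n) → Dec (MeetsCone P E)) → ℕ → ℕ
poinCoeff {n} P μ meets? k =
  sumℕ (map (λ X → ℤ.∣ μ X ∣)
    (filterᵇ (λ X → ⌊ meets? X ⌋ ∧ (codim X ≡ᵇ k)) (flats n)))

{-# OPTIONS --safe #-}
-- A flat meeting the cone of P has only singleton and two-element blocks, so it carries a
-- matching of incomparable pairs; since μ changes sign whenever two singleton blocks are merged,
-- |μ(V,X)| = 1 and Poin(P,t) counts such flats by their number of pairs.  Glueing the two entries
-- of every descent of a linear extension gives a flat of this kind, whose codimension is the
-- number of descents.  Conversely, such a flat X makes P into a preorder ≤_X (generated by P
-- and X), and σ is recovered from X by sorting: elements of the same chain are ordered by P,
-- while b ∉ P₁ precedes a ∈ P₁ exactly when b ≤_X a.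
module Submission where

open import Defs
open import Data.Bool as Bool using (Bool; true; false; _∧_; _∨_; not; if_then_else_)
open import Data.Bool.ListAction using (all; any)
open import Data.Bool.Properties using (T?; T-≡)
open import Data.Empty using (⊥-elim)
open import Data.Fin as Fin using (Fin; toℕ)
import Data.Fin.Properties as Finₚ
open import Data.Fin.Subset using (Subset; _∪_; ⊤) renaming (_∈_ to _∈ₛ_)
open import Data.Fin.Subset.Properties using (_∈?_; x∈p∪q⁻; ∈⊤)
open import Data.Integer as ℤ using (ℤ) renaming (_+_ to _⊕_)
import Data.Integer.Properties as ℤₚ
open import Data.List using (List; []; _∷_; map; concatMap; filterᵇ; allFin; length; _++_)
import Data.List.Membership.DecPropositional as DecMembership
open import Data.List.Membership.Propositional using (_∈_; _∉_)
open import Data.List.Membership.Propositional.Properties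
  using (∈-map⁺; ∈-map⁻; ∈-filter⁺; ∈-filter⁻; ∈-++⁺ˡ; ∈-++⁺ʳ; ∈-++⁻; ∈-∃++; ∈-allFin)
open import Data.List.Membership.Propositional.Properties.WithK using (unique∧set⇒bag)
open import Data.List.Properties using (length-++; length-map; length-tabulate; map-∘)
open import Data.List.Relation.Binary.BagAndSetEquality using (∼bag⇒↭)
open import Data.List.Relation.Binary.Permutation.Propositional as Perm using (_↭_)
open import Data.List.Relation.Binary.Permutation.Propositional.Properties using (↭-length; ∈-resp-↭)
import Data.List.Relation.Binary.Permutation.Setoid.Properties as Permₛ
open import Data.List.Relation.Unary.All as All using (All; []; _∷_)
open import Data.List.Relation.Unary.All.Properties using (¬Any⇒All¬)
open import Data.List.Relation.Unary.AllPairs as AllPairs using (AllPairs; []; _∷_)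
open import Data.List.Relation.Unary.Any using (here; there)
open import Data.List.Relation.Unary.Sorted.TotalOrder.Properties using (Sorted⇒AllPairs)
open import Data.List.Relation.Unary.Unique.Propositional using (Unique)
import Data.List.Relation.Unary.Unique.Propositional.Properties as Unique
import Data.List.Sort as Sort
open import Data.Nat using (ℕ; zero; suc; _+_; _∸_; _≤_; _<_; z≤n; s≤s; _<ᵇ_; _≡ᵇ_)
import Data.Nat.Coprimality as Coprime
import Data.Nat.Properties as ℕₚ
open import Data.Product using (∃; ∃₂; _×_; _,_; proj₁; proj₂)
open import Data.Rational as ℚ using (ℚ; mkℚ)
import Data.Rational.Properties as ℚₚ
open import Data.Sum as Sum using (_⊎_; inj₁; inj₂; [_,_]′)
open import Data.Vec as Vec using (Vec; lookup; toList)
import Data.Vec.Properties as Vecₚ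
open import Function using (_∘_; id; mk⇔; Equivalence)
open import Relation.Binary
  using (Asymmetric; DecTotalOrder; IsDecStrictPartialOrder; IsStrictTotalOrder; Trichotomous; tri<; tri≈; tri>)
import Relation.Binary.Construct.StrictToNonStrict as ToNonStrict
open import Relation.Binary.PropositionalEquality
open import Relation.Nullary using (¬_; Dec; yes; no; contradiction)
open import Relation.Nullary.Decidable as Dec using (⌊_⌋; _×-dec_; _⊎-dec_)

open Equivalence using (to; from)

-- Descents never overlap, since the second entry of one lies in `P₁` and the first entry of the
-- next would lie outside it. Hence `descentFlat` is built by merging one pair of singletons per
-- descent, and both `|μ|` and the codimension follow the same recursion. For the inverse, ≤_X
-- leaves many pairs from different chains unordered, while a list needs a total order. Putting the
-- element of `P₁` first is the only possible default: if an unordered pair were adjacent with its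
-- `P₁` entry second, it would be a descent that X does not record. The resulting relation `_⊢_≺_`
-- is a strict total order for every matrix, because a crossing to the other chain and back is
-- settled by comparability inside one chain. A point of the cone enters through one inequality: its
-- coordinates weakly increase along ≤_X. This is what makes the sorted list extend P and places
-- glued entries side by side. For injectivity, a linear extension is itself sorted for its own
-- flat, and a sorted list is determined by its entries.

private variable
  A B : Set
  n : ℕ

-- Boolean reflection

∧⁺ : ∀ {a b} → a ≡ true → b ≡ true → a ∧ b ≡ true
∧⁺ refl refl = refl

∧⁻ : ∀ {a b} → a ∧ b ≡ true → a ≡ true × b ≡ true
∧⁻ {true} {true} _ = refl , refl

∨⁺ : ∀ {a b} → a ≡ true ⊎ b ≡ true → a ∨ b ≡ true
∨⁺ {true}  _           = refl
∨⁺ {false} (inj₂ refl) = refl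

∨⁻ : ∀ {a b} → a ∨ b ≡ true → a ≡ true ⊎ b ≡ true
∨⁻ {true}  _ = inj₁ refl
∨⁻ {false} p = inj₂ p

⇒⁺ : ∀ {a b} → (a ≡ true → b ≡ true) → not a ∨ b ≡ true
⇒⁺ {true}  f = f refl
⇒⁺ {false} f = refl

⇒⁻ : ∀ {a b} → not a ∨ b ≡ true → a ≡ true → b ≡ true
⇒⁻ p refl = p

not⁺ : ∀ {a} → ¬ (a ≡ true) → not a ≡ true
not⁺ {true}  f = contradiction refl f
not⁺ {false} f = refl

not⁻ : ∀ {a} → not a ≡ true → ¬ (a ≡ true)
not⁻ {true} ()
not⁻ {false} _ ()

≡true-ext : ∀ {a b} → (a ≡ true → b ≡ true) → (b ≡ true → a ≡ true) → a ≡ b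
≡true-ext {true}          f g = sym (f refl)
≡true-ext {false} {false} f g = refl
≡true-ext {false} {true}  f g = g refl

⌊⌋⁺ : (a? : Dec A) → A → ⌊ a? ⌋ ≡ true
⌊⌋⁺ (yes _) _ = refl
⌊⌋⁺ (no ¬a) a = contradiction a ¬a

⌊⌋⁻ : (a? : Dec A) → ⌊ a? ⌋ ≡ true → A
⌊⌋⁻ (yes a) _ = a

all⁺ : ∀ (p : A → Bool) xs → (∀ x → x ∈ xs → p x ≡ true) → all p xs ≡ true
all⁺ p []       f = refl
all⁺ p (x ∷ xs) f = ∧⁺ (f x (here refl)) (all⁺ p xs (λ y → f y ∘ there))

all⁻ : ∀ (p : A → Bool) xs → all p xs ≡ true → ∀ {x} → x ∈ xs → p x ≡ true
all⁻ p (x ∷ xs) q (here refl) = proj₁ (∧⁻ q)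
all⁻ p (x ∷ xs) q (there i)   = all⁻ p xs (proj₂ (∧⁻ q)) i

any⁺ : ∀ (p : A → Bool) xs {x} → x ∈ xs → p x ≡ true → any p xs ≡ true
any⁺ p (x ∷ xs) (here refl) q = ∨⁺ (inj₁ q)
any⁺ p (x ∷ xs) (there i)   q = ∨⁺ (inj₂ (any⁺ p xs i q))

any⁻ : ∀ (p : A → Bool) xs → any p xs ≡ true → ∃ λ x → p x ≡ true
any⁻ p (x ∷ xs) q with ∨⁻ {p x} q
... | inj₁ r = x , r
... | inj₂ r = any⁻ p xs r

∀Fin⁺ : (p : Fin n → Bool) → (∀ i → p i ≡ true) → all p (allFin n) ≡ true
∀Fin⁺ {n} p f = all⁺ p (allFin n) (λ i _ → f i)

∀Fin⁻ : (p : Fin n → Bool) → all p (allFin n) ≡ true → ∀ i → p i ≡ true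
∀Fin⁻ {n} p q i = all⁻ p (allFin n) q (∈-allFin i)

-- Duplicate-free lists and enumerations

∈-filterᵇ⁺ : (p : A → Bool) {x : A} {xs : List A} → x ∈ xs → p x ≡ true → x ∈ filterᵇ p xs
∈-filterᵇ⁺ p x∈xs px = ∈-filter⁺ (T? ∘ p) x∈xs (from T-≡ px)

∈-filterᵇ⁻ : (p : A → Bool) {x : A} {xs : List A} → x ∈ filterᵇ p xs → x ∈ xs × p x ≡ true
∈-filterᵇ⁻ p x∈ with x∈xs , px ← ∈-filter⁻ (T? ∘ p) x∈ = x∈xs , to T-≡ px

unique-filterᵇ : (p : A → Bool) {xs : List A} → Unique xs → Unique (filterᵇ p xs)
unique-filterᵇ p = Unique.filter⁺ (T? ∘ p)

length-filterᵇ-not : (p : A → Bool) (xs : List A) →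
  length (filterᵇ p xs) + length (filterᵇ (not ∘ p) xs) ≡ length xs
length-filterᵇ-not p [] = refl
length-filterᵇ-not p (x ∷ xs) with p x
... | true  = cong suc (length-filterᵇ-not p xs)
... | false = trans (ℕₚ.+-suc _ _) (cong suc (length-filterᵇ-not p xs))

unique-↭ : {xs ys : List A} → Unique xs → Unique ys →
  (∀ {z} → z ∈ xs → z ∈ ys) → (∀ {z} → z ∈ ys → z ∈ xs) → xs ↭ ys
unique-↭ u v f g = ∼bag⇒↭ (unique∧set⇒bag u v (mk⇔ f g))

unique-⊆-length : {xs ys : List A} → Unique xs → (∀ {z} → z ∈ xs → z ∈ ys) → length xs ≤ length ys
unique-⊆-length [] _ = z≤n
unique-⊆-length {xs = x ∷ xs} u@(_ ∷ u′) f with as , bs , refl ← ∈-∃++ (f (here refl)) =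
  subst (suc (length xs) ≤_) (sym (trans (length-++ as) (trans (ℕₚ.+-suc _ _) (cong suc (sym (length-++ as))))))
    (s≤s (unique-⊆-length u′ sub))
  where
  sub : ∀ {z} → z ∈ xs → z ∈ as ++ bs
  sub z∈xs with ∈-++⁻ as (f (there z∈xs))
  ... | inj₁ z∈as          = ∈-++⁺ˡ z∈as
  ... | inj₂ (here refl)   = ⊥-elim (Unique.Unique[x∷xs]⇒x∉xs u z∈xs)
  ... | inj₂ (there z∈bs)  = ∈-++⁺ʳ as z∈bs

unique-map : (f : A → B) {xs : List A} → (∀ {x y} → x ∈ xs → y ∈ xs → f x ≡ f y → x ≡ y) →
  Unique xs → Unique (map f xs)
unique-map f inj [] = []
unique-map f {x ∷ xs} inj u@(_ ∷ u′) =
  ¬Any⇒All¬ _ fx∉ ∷ unique-map f (λ i j → inj (there i) (there j)) u′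
  where
  fx∉ : f x ∉ map f xs
  fx∉ fx∈ with y , y∈xs , eq ← ∈-map⁻ f fx∈ =
    Unique.Unique[x∷xs]⇒x∉xs u (subst (_∈ xs) (sym (inj (here refl) (there y∈xs) eq)) y∈xs)

∈-allVecs : {xs : List A} → (∀ x → x ∈ xs) → ∀ {k} (v : Vec A k) → v ∈ allVecs xs k
∈-allVecs all∈ Vec.[] = here refl
∈-allVecs {A = A} {xs = xs} all∈ {suc k} (x Vec.∷ v) = go (all∈ x)
  where
  go : ∀ {ys} → x ∈ ys → x Vec.∷ v ∈ concatMap (λ y → map (y Vec.∷_) (allVecs xs k)) ys
  go (here refl) = ∈-++⁺ˡ (∈-map⁺ _ (∈-allVecs all∈ v))
  go (there i)   = ∈-++⁺ʳ _ (go i)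

unique-allVecs : {xs : List A} → Unique xs → ∀ k → Unique (allVecs xs k)
unique-allVecs u zero = [] ∷ []
unique-allVecs {A = A} {xs = xs} u (suc k) = proj₁ (go u)
  where
  block : List A → List (Vec A (suc k))
  block = concatMap (λ y → map (y Vec.∷_) (allVecs xs k))
  -- The second component is carried along to keep the blocks for different first entries disjoint.
  go : ∀ {ys} → Unique ys → Unique (block ys) × (∀ {v} → v ∈ block ys → Vec.head v ∈ ys)
  go [] = [] , λ ()
  go {y ∷ ys} u′@(_ ∷ u″) with ub , hd ← go u″ =
    Unique.++⁺ (Unique.map⁺ (Vecₚ.∷-injectiveʳ) (unique-allVecs u k)) ub disjoint , heads
    where
    disjoint : ∀ {v} → ¬ (v ∈ map (y Vec.∷_) (allVecs xs k) × v ∈ block ys)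
    disjoint (p , q) with _ , _ , refl ← ∈-map⁻ _ p = Unique.Unique[x∷xs]⇒x∉xs u′ (hd q)
    heads : ∀ {v} → v ∈ map (y Vec.∷_) (allVecs xs k) ++ block ys → Vec.head v ∈ y ∷ ys
    heads p with ∈-++⁻ (map (y Vec.∷_) (allVecs xs k)) p
    ... | inj₁ q with _ , _ , refl ← ∈-map⁻ _ q = here refl
    ... | inj₂ q = there (hd q)

-- Integer sums over lists

sumℤ-↭ : (f : A → ℤ) {xs ys : List A} → xs ↭ ys → sumℤ (map f xs) ≡ sumℤ (map f ys)
sumℤ-↭ f Perm.refl         = refl
sumℤ-↭ f (Perm.prep x p)   = cong (f x ⊕_) (sumℤ-↭ f p)
sumℤ-↭ f (Perm.swap {xs} {ys} x y p) = begin
  f x ⊕ (f y ⊕ sumℤ (map f xs)) ≡⟨ ℤₚ.+-assoc (f x) (f y) _ ⟨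
  f x ⊕ f y ⊕ sumℤ (map f xs)   ≡⟨ cong₂ _⊕_ (ℤₚ.+-comm (f x) (f y)) (sumℤ-↭ f p) ⟩
  f y ⊕ f x ⊕ sumℤ (map f ys)   ≡⟨ ℤₚ.+-assoc (f y) (f x) _ ⟩
  f y ⊕ (f x ⊕ sumℤ (map f ys)) ∎
  where open ≡-Reasoning
sumℤ-↭ f (Perm.trans p q)  = trans (sumℤ-↭ f p) (sumℤ-↭ f q)

sumℤ-++ : (f : A → ℤ) (xs ys : List A) →
  sumℤ (map f (xs ++ ys)) ≡ sumℤ (map f xs) ⊕ sumℤ (map f ys)
sumℤ-++ f []       ys = sym (ℤₚ.+-identityˡ _)
sumℤ-++ f (x ∷ xs) ys = trans (cong (f x ⊕_) (sumℤ-++ f xs ys)) (sym (ℤₚ.+-assoc (f x) _ _))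

sumℤ-map-+ : (f g : A → ℤ) (xs : List A) →
  sumℤ (map f xs) ⊕ sumℤ (map g xs) ≡ sumℤ (map (λ x → f x ⊕ g x) xs)
sumℤ-map-+ f g []       = refl
sumℤ-map-+ f g (x ∷ xs) = begin
  (f x ⊕ F) ⊕ (g x ⊕ G)   ≡⟨ ℤₚ.+-assoc (f x) F _ ⟩
  f x ⊕ (F ⊕ (g x ⊕ G))   ≡⟨ cong (f x ⊕_) (ℤₚ.+-assoc F (g x) G) ⟨
  f x ⊕ (F ⊕ g x ⊕ G)     ≡⟨ cong (λ u → f x ⊕ (u ⊕ G)) (ℤₚ.+-comm F (g x)) ⟩
  f x ⊕ (g x ⊕ F ⊕ G)     ≡⟨ cong (f x ⊕_) (ℤₚ.+-assoc (g x) F G) ⟩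
  f x ⊕ (g x ⊕ (F ⊕ G))   ≡⟨ ℤₚ.+-assoc (f x) (g x) _ ⟨
  f x ⊕ g x ⊕ (F ⊕ G)     ≡⟨ cong (f x ⊕ g x ⊕_) (sumℤ-map-+ f g xs) ⟩
  f x ⊕ g x ⊕ sumℤ (map (λ x → f x ⊕ g x) xs) ∎
  where
  open ≡-Reasoning
  F = sumℤ (map f xs)
  G = sumℤ (map g xs)

sumℤ-zero : (f : A → ℤ) (xs : List A) → (∀ {x} → x ∈ xs → f x ≡ ℤ.0ℤ) → sumℤ (map f xs) ≡ ℤ.0ℤ
sumℤ-zero f []       h = refl
sumℤ-zero f (x ∷ xs) h = cong₂ _⊕_ (h (here refl)) (sumℤ-zero f xs (h ∘ there))

sumℤ-single : (f : A → ℤ) {xs : List A} {x : A} → Unique xs → x ∈ xs →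
  (∀ {y} → y ∈ xs → y ≢ x → f y ≡ ℤ.0ℤ) → sumℤ (map f xs) ≡ f x
sumℤ-single f {x ∷ xs} u (here refl) h =
  trans (cong (f x ⊕_) (sumℤ-zero f xs λ y∈xs → h (there y∈xs) λ { refl → Unique.Unique[x∷xs]⇒x∉xs u y∈xs }))
        (ℤₚ.+-identityʳ _)
sumℤ-single f {y ∷ xs} u@(_ ∷ u′) (there x∈xs) h =
  trans (cong₂ _⊕_ (h (here refl) λ { refl → Unique.Unique[x∷xs]⇒x∉xs u x∈xs })
                     (sumℤ-single f u′ x∈xs (h ∘ there)))
        (ℤₚ.+-identityˡ _)

-- Flats and the Möbius function

-- A record rather than the bare equation, which unfolds to nested lookups from which `X`, `a` and
-- `b` cannot be inferred.
record Rel (X : Mat n) (a b : Fin n) : Set where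
  constructor related
  field rel≡true : rel X a b ≡ true
open Rel

mat-ext : {X Y : Mat n} → (∀ a b → Rel X a b → Rel Y a b) → (∀ a b → Rel Y a b → Rel X a b) → X ≡ Y
mat-ext f g = lookup-ext λ a → lookup-ext λ b → ≡true-ext (rel≡true ∘ f a b ∘ related) (rel≡true ∘ g a b ∘ related)
  where
  lookup-ext : ∀ {A : Set} {k} {v w : Vec A k} → (∀ i → lookup v i ≡ lookup w i) → v ≡ w
  lookup-ext h = trans (sym (Vecₚ.tabulate∘lookup _)) (trans (Vecₚ.tabulate-cong h) (Vecₚ.tabulate∘lookup _))

rel-tabulate : (f : Fin n → Fin n → Bool) → ∀ a b →
  rel (Vec.tabulate λ i → Vec.tabulate (f i)) a b ≡ f a b
rel-tabulate f a b =
  trans (cong (λ v → lookup v b) (Vecₚ.lookup∘tabulate (λ i → Vec.tabulate (f i)) a))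
        (Vecₚ.lookup∘tabulate (f a) b)

idRel⁺ : ∀ (a : Fin n) → Rel idRel a a
idRel⁺ a = related (trans (rel-tabulate _ a a) (⌊⌋⁺ (a Fin.≟ a) refl))

idRel⁻ : ∀ {a b : Fin n} → Rel idRel a b → a ≡ b
idRel⁻ {a = a} {b} (related r) = ⌊⌋⁻ (a Fin.≟ b) (trans (sym (rel-tabulate _ a b)) r)

record IsEquiv (X : Mat n) : Set where
  field
    ≈-refl  : ∀ a → Rel X a a
    ≈-sym   : ∀ {a b} → Rel X a b → Rel X b a
    ≈-trans : ∀ {a b c} → Rel X a b → Rel X b c → Rel X a c
open IsEquiv

isEquiv⁺ : {X : Mat n} → IsEquiv X → isEquivᵇ X ≡ true
isEquiv⁺ {X = X} e =
  ∧⁺ (∀Fin⁺ _ λ a → rel≡true (≈-refl e a))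
 (∧⁺ (∀Fin⁺ _ λ a → ∀Fin⁺ _ λ b → ⇒⁺ {rel X a b} λ p → rel≡true (≈-sym e (related p)))
     (∀Fin⁺ _ λ a → ∀Fin⁺ _ λ b → ∀Fin⁺ _ λ c → ⇒⁺ {rel X a b ∧ rel X b c} λ p →
        rel≡true (≈-trans e (related (proj₁ (∧⁻ p))) (related (proj₂ (∧⁻ {rel X a b} p))))))

isEquiv⁻ : {X : Mat n} → isEquivᵇ X ≡ true → IsEquiv X
isEquiv⁻ {X = X} p with r , p′ ← ∧⁻ p with s , t ← ∧⁻ p′ = record
  { ≈-refl  = λ a → related (∀Fin⁻ _ r a)
  ; ≈-sym   = λ {a} {b} (related u) → related (⇒⁻ (∀Fin⁻ _ (∀Fin⁻ _ s a) b) u)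
  ; ≈-trans = λ {a} {b} {c} (related u) (related v) →
      related (⇒⁻ {rel X a b ∧ rel X b c} (∀Fin⁻ _ (∀Fin⁻ _ (∀Fin⁻ _ t a) b) c) (∧⁺ u v))
  }

idRel-isEquiv : IsEquiv (idRel {n})
idRel-isEquiv = record
  { ≈-refl  = idRel⁺
  ; ≈-sym   = λ {a} r → subst (λ b → Rel idRel b a) (idRel⁻ r) (idRel⁺ a)
  ; ≈-trans = λ {a} r s → subst (Rel idRel a) (idRel⁻ s) r
  }

_⊑_ : Mat n → Mat n → Set
X ⊑ Y = ∀ {a b} → Rel X a b → Rel Y a b

⊑⁺ : {X Y : Mat n} → X ⊑ Y → X ⊑ᵇ Y ≡ true
⊑⁺ {X = X} f = ∀Fin⁺ _ λ a → ∀Fin⁺ _ λ b → ⇒⁺ {rel X a b} λ p → rel≡true (f (related p))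

⊑⁻ : {X Y : Mat n} → X ⊑ᵇ Y ≡ true → X ⊑ Y
⊑⁻ p {a} {b} (related r) = related (⇒⁻ (∀Fin⁻ _ (∀Fin⁻ _ p a) b) r)

unique-flats : ∀ n → Unique (flats n)
unique-flats n = unique-filterᵇ isEquivᵇ (unique-allVecs (unique-allVecs bools n) n)
  where
  bools : Unique (true ∷ false ∷ [])
  bools = ((λ ()) ∷ []) ∷ [] ∷ []

∈-flats : {X : Mat n} → IsEquiv X → X ∈ flats n
∈-flats e = ∈-filterᵇ⁺ isEquivᵇ (∈-allVecs (∈-allVecs bool∈) _) (isEquiv⁺ e)
  where
  bool∈ : ∀ b → b ∈ true ∷ false ∷ []
  bool∈ true  = here refl
  bool∈ false = there (here refl)

∈-flats⁻ : {X : Mat n} → X ∈ flats n → IsEquiv X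
∈-flats⁻ p = isEquiv⁻ (proj₂ (∈-filterᵇ⁻ isEquivᵇ {xs = allVecs (allVecs (true ∷ false ∷ []) _) _} p))

below : Mat n → List (Mat n)
below {n} X = filterᵇ (λ Y → Y ⊑ᵇ X) (flats n)

unique-below : (X : Mat n) → Unique (below X)
unique-below X = unique-filterᵇ _ (unique-flats _)

∈-below⁺ : (X : Mat n) {Y : Mat n} → IsEquiv Y → Y ⊑ X → Y ∈ below X
∈-below⁺ X {Y} e s = ∈-filterᵇ⁺ _ (∈-flats e) (⊑⁺ {X = Y} {X} s)

∈-below⁻ : (X : Mat n) {Y : Mat n} → Y ∈ below X → IsEquiv Y × Y ⊑ X
∈-below⁻ X {Y} p with q , s ← ∈-filterᵇ⁻ (λ Y → Y ⊑ᵇ X) p =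
  ∈-flats⁻ q , ⊑⁻ {X = Y} {X} s

-- `X` lies below itself but not below `Y`. The number of flats below thus serves as the measure for
-- induction in the lattice.
below-< : {X Y : Mat n} → IsEquiv X → Y ∈ below X → Y ≢ X → length (below Y) < length (below X)
below-< {X = X} {Y} e Y∈ Y≢X =
  unique-⊆-length (¬Any⇒All¬ _ X∉ ∷ unique-below Y) sub
  where
  Y⊑X : Y ⊑ X
  Y⊑X = proj₂ (∈-below⁻ X Y∈)
  X∉ : X ∉ below Y
  X∉ X∈ = Y≢X (mat-ext (λ _ _ → Y⊑X) (λ _ _ → proj₂ (∈-below⁻ Y X∈)))
  sub : ∀ {Z} → Z ∈ X ∷ below Y → Z ∈ below X
  sub (here refl) = ∈-below⁺ X e (λ r → r)
  sub (there Z∈)  = ∈-below⁺ X (proj₁ (∈-below⁻ Y Z∈)) (Y⊑X ∘ proj₂ (∈-below⁻ Y Z∈))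

-- Merging two singleton blocks

data Link {A : Set} (i j : A) : A → A → Set where
  fwd : Link i j i j
  bwd : Link i j j i

-- Only the two pairs joining `i` and `j` are added, with no transitive closure. When `i` and `j`
-- are singleton blocks of a flat, this is already its join with the hyperplane `H_ij`.
merge : Fin n → Fin n → Mat n → Mat n
merge i j X = Vec.tabulate λ a → Vec.tabulate λ b →
  rel X a b ∨ (⌊ a Fin.≟ i ⌋ ∧ ⌊ b Fin.≟ j ⌋ ∨ ⌊ a Fin.≟ j ⌋ ∧ ⌊ b Fin.≟ i ⌋)

merge⁺ : ∀ {i j : Fin n} {X a b} → Rel X a b ⊎ Link i j a b → Rel (merge i j X) a b
merge⁺ {i = i} {j} {X} {a} {b} p = related (trans (rel-tabulate _ a b) (go p))
  where
  go : Rel X a b ⊎ Link i j a b → _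
  go (inj₁ (related r)) = ∨⁺ (inj₁ r)
  go (inj₂ fwd) = ∨⁺ {rel X i j} (inj₂ (∨⁺ (inj₁ (∧⁺ (⌊⌋⁺ (i Fin.≟ i) refl) (⌊⌋⁺ (j Fin.≟ j) refl)))))
  go (inj₂ bwd) = ∨⁺ {rel X j i} (inj₂ (∨⁺ {⌊ j Fin.≟ i ⌋ ∧ ⌊ i Fin.≟ j ⌋}
                    (inj₂ (∧⁺ (⌊⌋⁺ (j Fin.≟ j) refl) (⌊⌋⁺ (i Fin.≟ i) refl)))))

merge⁻ : ∀ {i j : Fin n} {X a b} → Rel (merge i j X) a b → Rel X a b ⊎ Link i j a b
merge⁻ {i = i} {j} {X} {a} {b} (related r) with ∨⁻ {rel X a b} (trans (sym (rel-tabulate _ a b)) r)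
... | inj₁ p = inj₁ (related p)
... | inj₂ q with ∨⁻ {⌊ a Fin.≟ i ⌋ ∧ ⌊ b Fin.≟ j ⌋} q
...   | inj₁ s with refl ← ⌊⌋⁻ (a Fin.≟ i) (proj₁ (∧⁻ s))
               | refl ← ⌊⌋⁻ (b Fin.≟ j) (proj₂ (∧⁻ {⌊ a Fin.≟ i ⌋} s)) = inj₂ fwd
...   | inj₂ s with refl ← ⌊⌋⁻ (a Fin.≟ j) (proj₁ (∧⁻ s))
               | refl ← ⌊⌋⁻ (b Fin.≟ i) (proj₂ (∧⁻ {⌊ a Fin.≟ j ⌋} s)) = inj₂ bwd

Isolated : Mat n → Fin n → Set
Isolated X i = ∀ {a} → Rel X i a → a ≡ i

module _ {i j : Fin n} where

  merge-isEquiv : ∀ {X} → IsEquiv X → Isolated X i → Isolated X j → IsEquiv (merge i j X)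
  merge-isEquiv {X} e iso-i iso-j = record
    { ≈-refl  = λ a → merge⁺ (inj₁ (≈-refl e a))
    ; ≈-sym   = λ r → merge⁺ (symm (merge⁻ r))
    ; ≈-trans = λ r s → merge⁺ (tr (merge⁻ r) (merge⁻ s))
    }
    where
    R : Fin n → Fin n → Set
    R a b = Rel X a b ⊎ Link i j a b
    symm : ∀ {a b} → R a b → R b a
    symm (inj₁ r)   = inj₁ (≈-sym e r)
    symm (inj₂ fwd) = inj₂ bwd
    symm (inj₂ bwd) = inj₂ fwd
    tr : ∀ {a b c} → R a b → R b c → R a c
    tr (inj₁ r)   (inj₁ s)   = inj₁ (≈-trans e r s)
    tr (inj₁ r)   (inj₂ fwd) with refl ← iso-i (≈-sym e r) = inj₂ fwd
    tr (inj₁ r)   (inj₂ bwd) with refl ← iso-j (≈-sym e r) = inj₂ bwd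
    tr (inj₂ fwd) (inj₁ s)   with refl ← iso-j s = inj₂ fwd
    tr (inj₂ bwd) (inj₁ s)   with refl ← iso-i s = inj₂ bwd
    tr (inj₂ fwd) (inj₂ fwd) = inj₂ fwd
    tr (inj₂ fwd) (inj₂ bwd) = inj₁ (≈-refl e i)
    tr (inj₂ bwd) (inj₂ fwd) = inj₁ (≈-refl e j)
    tr (inj₂ bwd) (inj₂ bwd) = inj₂ bwd

  -- The flats below merge i j X that join i and j are the merge i j Y with Y below X;
  -- such a flat Z is recovered as merge i j (Z ∩ X).
  below-merge : ∀ {X} → IsEquiv X → Isolated X i → Isolated X j → i ≢ j →
    below (merge i j X) ↭ below X ++ map (merge i j) (below X)
  below-merge {X} e iso-i iso-j i≢j =
    unique-↭ (unique-below (merge i j X))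
      (Unique.++⁺ (unique-below X) (unique-map _ injective (unique-below X)) disjoint) f g
    where
    ¬ij : ∀ {a b} → Link i j a b → ¬ Rel X a b
    ¬ij fwd r = i≢j (sym (iso-i r))
    ¬ij bwd r = i≢j (iso-j r)
    merge-cancel : ∀ {Y Z} → Y ∈ below X → merge i j Y ≡ merge i j Z → Y ⊑ Z
    merge-cancel Y∈ eq {a} {b} r
      with merge⁻ (subst (λ M → Rel M a b) eq (merge⁺ (inj₁ r)))
    ... | inj₁ s = s
    ... | inj₂ l = ⊥-elim (¬ij l (proj₂ (∈-below⁻ X Y∈) r))
    injective : ∀ {Y Z} → Y ∈ below X → Z ∈ below X → merge i j Y ≡ merge i j Z → Y ≡ Z
    injective Y∈ Z∈ eq = mat-ext (λ _ _ → merge-cancel Y∈ eq) (λ _ _ → merge-cancel Z∈ (sym eq))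
    disjoint : ∀ {Y} → ¬ (Y ∈ below X × Y ∈ map (merge i j) (below X))
    disjoint (p , q) with Z , _ , refl ← ∈-map⁻ _ q =
      ¬ij fwd (proj₂ (∈-below⁻ X p) (merge⁺ {X = Z} (inj₂ fwd)))
    g : ∀ {Y} → Y ∈ below X ++ map (merge i j) (below X) → Y ∈ below (merge i j X)
    g p with ∈-++⁻ (below X) p
    ... | inj₁ q with eY , Y⊑X ← ∈-below⁻ X q = ∈-below⁺ (merge i j X) eY (merge⁺ ∘ inj₁ ∘ Y⊑X)
    ... | inj₂ q with Z , Z∈ , refl ← ∈-map⁻ (merge i j) q with eZ , Z⊑X ← ∈-below⁻ X Z∈ =
      ∈-below⁺ (merge i j X) (merge-isEquiv eZ (iso-i ∘ Z⊑X) (iso-j ∘ Z⊑X))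
        λ r → merge⁺ ([ inj₁ ∘ Z⊑X , inj₂ ]′ (merge⁻ {X = Z} r))
    f : ∀ {Y} → Y ∈ below (merge i j X) → Y ∈ below X ++ map (merge i j) (below X)
    f {Y} p with eY , Y⊑ ← ∈-below⁻ (merge i j X) p with rel Y i j in eq
    ... | false = ∈-++⁺ˡ (∈-below⁺ X eY λ r → [ (λ s → s) , (λ l → ⊥-elim (¬link l r)) ]′ (merge⁻ (Y⊑ r)))
      where
      ¬link : ∀ {a b} → Link i j a b → ¬ Rel Y a b
      ¬link fwd (related r) with () ← trans (sym eq) r
      ¬link bwd r with related s ← ≈-sym eY r with () ← trans (sym eq) s
    ... | true = ∈-++⁺ʳ (below X) (subst (_∈ map (merge i j) (below X)) merge-Z
                   (∈-map⁺ (merge i j) (∈-below⁺ X eZ (proj₂ ∘ Z⁻))))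
      where
      Z : Mat n
      Z = Vec.tabulate λ a → Vec.tabulate λ b → rel Y a b ∧ rel X a b
      Z⁺ : ∀ {a b} → Rel Y a b → Rel X a b → Rel Z a b
      Z⁺ {a} {b} (related r) (related s) = related (trans (rel-tabulate _ a b) (∧⁺ r s))
      Z⁻ : ∀ {a b} → Rel Z a b → Rel Y a b × Rel X a b
      Z⁻ {a} {b} (related r) with p , q ← ∧⁻ {rel Y a b} (trans (sym (rel-tabulate _ a b)) r) =
        related p , related q
      eZ : IsEquiv Z
      eZ = record
        { ≈-refl  = λ a → Z⁺ (≈-refl eY a) (≈-refl e a)
        ; ≈-sym   = λ r → Z⁺ (≈-sym eY (proj₁ (Z⁻ r))) (≈-sym e (proj₂ (Z⁻ r)))
        ; ≈-trans = λ r s → Z⁺ (≈-trans eY (proj₁ (Z⁻ r)) (proj₁ (Z⁻ s)))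
                               (≈-trans e (proj₂ (Z⁻ r)) (proj₂ (Z⁻ s)))
        }
      link : ∀ {a b} → Link i j a b → Rel Y a b
      link fwd = related eq
      link bwd = ≈-sym eY (related eq)
      merge-Z : merge i j Z ≡ Y
      merge-Z = mat-ext
        (λ _ _ r → [ proj₁ ∘ Z⁻ , link ]′ (merge⁻ {X = Z} r))
        (λ _ _ r → merge⁺ ([ inj₁ ∘ Z⁺ r , inj₂ ]′ (merge⁻ (Y⊑ r))))

module _ (μ : Mat n → ℤ) (μ-isMöbius : IsMöbius μ) {i j : Fin n} (i≢j : i ≢ j) where

  -- The Möbius recurrence at `merge i j X` sums `μ Y ⊕ μ (merge i j Y)` over the flats `Y` below
  -- `X`. By induction every such term with `Y ≢ X` vanishes, as `i` and `j` remain singletons in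
  -- `Y`, so the term at `X` vanishes too.
  μ-merge : ∀ {X} → IsEquiv X → Isolated X i → Isolated X j → μ X ⊕ μ (merge i j X) ≡ ℤ.0ℤ
  μ-merge {X} = go (suc (length (below X))) X ℕₚ.≤-refl
    where
    go : ∀ m X → length (below X) < m → IsEquiv X → Isolated X i → Isolated X j →
      μ X ⊕ μ (merge i j X) ≡ ℤ.0ℤ
    go (suc m) X (s≤s lt) e iso-i iso-j = begin
      μ X ⊕ μ (merge i j X)
        ≡⟨ sumℤ-single (λ Y → μ Y ⊕ μ (merge i j Y)) (unique-below X) (∈-below⁺ X e λ r → r) cancel ⟨
      sumℤ (map (λ Y → μ Y ⊕ μ (merge i j Y)) (below X))
        ≡⟨ sumℤ-map-+ μ (μ ∘ merge i j) (below X) ⟨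
      sumℤ (map μ (below X)) ⊕ sumℤ (map (μ ∘ merge i j) (below X))
        ≡⟨ cong (λ ys → sumℤ (map μ (below X)) ⊕ sumℤ ys) (map-∘ (below X)) ⟩
      sumℤ (map μ (below X)) ⊕ sumℤ (map μ (map (merge i j) (below X)))
        ≡⟨ sumℤ-++ μ (below X) _ ⟨
      sumℤ (map μ (below X ++ map (merge i j) (below X)))
        ≡⟨ sumℤ-↭ μ (below-merge e iso-i iso-j i≢j) ⟨
      sumℤ (map μ (below (merge i j X)))
        ≡⟨ proj₂ μ-isMöbius _ (isEquiv⁺ (merge-isEquiv e iso-i iso-j)) merge≢id ⟩
      ℤ.0ℤ ∎
      where
      open ≡-Reasoning
      merge≢id : merge i j X ≢ idRel
      merge≢id eq = i≢j (idRel⁻ (subst (λ M → Rel M i j) eq (merge⁺ {X = X} (inj₂ fwd))))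
      cancel : ∀ {Y} → Y ∈ below X → Y ≢ X → μ Y ⊕ μ (merge i j Y) ≡ ℤ.0ℤ
      cancel {Y} Y∈ Y≢X with eY , Y⊑X ← ∈-below⁻ X Y∈ =
        go m Y (ℕₚ.<-≤-trans (below-< e Y∈ Y≢X) lt) eY (iso-i ∘ Y⊑X) (iso-j ∘ Y⊑X)

  ∣μ-merge∣ : ∀ {X} → IsEquiv X → Isolated X i → Isolated X j → ℤ.∣ μ (merge i j X) ∣ ≡ ℤ.∣ μ X ∣
  ∣μ-merge∣ {X} e iso-i iso-j = begin
    ℤ.∣ μ (merge i j X) ∣   ≡⟨ cong ℤ.∣_∣ (ℤₚ.i-j≡0⇒i≡j (μ (merge i j X)) (ℤ.- μ X)
        (trans (cong (μ (merge i j X) ⊕_) (ℤₚ.neg-involutive (μ X)))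
        (trans (ℤₚ.+-comm _ (μ X)) (μ-merge e iso-i iso-j)))) ⟩
    ℤ.∣ ℤ.- μ X ∣           ≡⟨ ℤₚ.∣-i∣≡∣i∣ (μ X) ⟩
    ℤ.∣ μ X ∣               ∎
    where open ≡-Reasoning

-- Codimension under merging

nonMinimal : Mat n → Fin n → Bool
nonMinimal {n} X i = any (λ j → (toℕ j <ᵇ toℕ i) ∧ rel X j i) (allFin n)

nonMinimal⁺ : ∀ {X : Mat n} {i j} → toℕ j < toℕ i → Rel X j i → nonMinimal X i ≡ true
nonMinimal⁺ {n = n} j<i (related r) = any⁺ _ (allFin n) (∈-allFin _) (∧⁺ (to T-≡ (ℕₚ.<⇒<ᵇ j<i)) r)

nonMinimal⁻ : ∀ {X : Mat n} {i} → nonMinimal X i ≡ true → ∃ λ j → toℕ j < toℕ i × Rel X j i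
nonMinimal⁻ {n = n} {X = X} {i} p
  with j , q ← any⁻ (λ j → (toℕ j <ᵇ toℕ i) ∧ rel X j i) (allFin n) p
  with lt , r ← ∧⁻ {toℕ j <ᵇ toℕ i} q = j , ℕₚ.<ᵇ⇒< _ _ (from T-≡ lt) , related r

-- `numClasses` counts the indices with no smaller related index, so the codimension counts the
-- remaining ones. This form replaces truncated subtraction by the length of a list.
codim-nonMinimal : (X : Mat n) → codim X ≡ length (filterᵇ (nonMinimal X) (allFin n))
codim-nonMinimal {n} X = begin
  n ∸ numClasses X                   ≡⟨ cong (_∸ numClasses X) (length-tabulate {n = n} id) ⟨
  length (allFin n) ∸ numClasses X   ≡⟨ cong (_∸ numClasses X) (length-filterᵇ-not (nonMinimal X) (allFin n)) ⟨
  k + numClasses X ∸ numClasses X    ≡⟨ ℕₚ.m+n∸n≡m k (numClasses X) ⟩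
  k                                  ∎
  where
  open ≡-Reasoning
  k = length (filterᵇ (nonMinimal X) (allFin n))

codim-id : codim (idRel {n}) ≡ 0
codim-id {n} = trans (codim-nonMinimal (idRel {n})) (cong length (none (allFin n)))
  where
  none : ∀ xs → filterᵇ (nonMinimal (idRel {n})) xs ≡ []
  none [] = refl
  none (x ∷ xs) with nonMinimal idRel x in eq
  ... | false = none xs
  ... | true with j , j<x , r ← nonMinimal⁻ {X = idRel {n}} eq =
    ⊥-elim (ℕₚ.<-irrefl (cong toℕ (idRel⁻ r)) j<x)

-- Here `m` is the larger and `l` the smaller of `i` and `j`. The index `m` was alone in its block
-- and now has a smaller partner; no other index gains one.
codim-merge-at : ∀ {i j m l : Fin n} {X} → IsEquiv X → Isolated X m → toℕ l < toℕ m → Link i j l m →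
  (∀ {a b} → Link i j a b → toℕ a < toℕ b → b ≡ m) → codim (merge i j X) ≡ suc (codim X)
codim-merge-at {n} {i} {j} {m} {l} {X} e iso-m l<m lm only-m = begin
  codim (merge i j X)                                    ≡⟨ codim-nonMinimal (merge i j X) ⟩
  length (filterᵇ (nonMinimal (merge i j X)) (allFin n)) ≡⟨ ↭-length perm ⟩
  suc (length (filterᵇ (nonMinimal X) (allFin n)))       ≡⟨ cong suc (codim-nonMinimal X) ⟨
  suc (codim X)                                          ∎
  where
  open ≡-Reasoning
  m∉ : m ∉ filterᵇ (nonMinimal X) (allFin n)
  m∉ m∈ with k , k<m , r ← nonMinimal⁻ {X = X} (proj₂ (∈-filterᵇ⁻ (nonMinimal X) {xs = allFin n} m∈)) =
    ℕₚ.<-irrefl (cong toℕ (iso-m (≈-sym e r))) k<m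
  f : ∀ {z} → z ∈ filterᵇ (nonMinimal (merge i j X)) (allFin n) → z ∈ m ∷ filterᵇ (nonMinimal X) (allFin n)
  f z∈ with k , k<z , r ← nonMinimal⁻ {X = merge i j X} (proj₂ (∈-filterᵇ⁻ (nonMinimal (merge i j X)) {xs = allFin n} z∈))
    with merge⁻ {X = X} r
  ... | inj₁ s    = there (∈-filterᵇ⁺ _ (∈-allFin _) (nonMinimal⁺ {X = X} k<z s))
  ... | inj₂ link = here (only-m link k<z)
  g : ∀ {z} → z ∈ m ∷ filterᵇ (nonMinimal X) (allFin n) → z ∈ filterᵇ (nonMinimal (merge i j X)) (allFin n)
  g (here refl) = ∈-filterᵇ⁺ _ (∈-allFin m) (nonMinimal⁺ {X = merge i j X} l<m (merge⁺ {X = X} (inj₂ lm)))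
  g (there z∈) with k , k<z , r ← nonMinimal⁻ {X = X} (proj₂ (∈-filterᵇ⁻ (nonMinimal X) {xs = allFin n} z∈)) =
    ∈-filterᵇ⁺ _ (∈-allFin _) (nonMinimal⁺ {X = merge i j X} k<z (merge⁺ (inj₁ r)))
  perm : filterᵇ (nonMinimal (merge i j X)) (allFin n) ↭ m ∷ filterᵇ (nonMinimal X) (allFin n)
  perm = unique-↭ (unique-filterᵇ _ (Unique.allFin⁺ n))
    (¬Any⇒All¬ _ m∉ ∷ unique-filterᵇ _ (Unique.allFin⁺ n)) f g

codim-merge : ∀ {i j : Fin n} {X} → i ≢ j → IsEquiv X → Isolated X i → Isolated X j →
  codim (merge i j X) ≡ suc (codim X)
codim-merge {n} {i} {j} {X} i≢j e iso-i iso-j with Finₚ.<-cmp i j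
... | tri≈ _ i≡j _ = ⊥-elim (i≢j i≡j)
... | tri< i<j _ _ = codim-merge-at e iso-j i<j fwd
        λ { fwd _ → refl ; bwd j<i → ⊥-elim (ℕₚ.<-asym i<j j<i) }
... | tri> _ _ j<i = codim-merge-at e iso-i j<i bwd
        λ { bwd _ → refl ; fwd i<j → ⊥-elim (ℕₚ.<-asym i<j j<i) }

-- Linear orderings as lists

data Before {A : Set} : List A → A → A → Set where
  here  : ∀ {a b l} → b ∈ l → Before (a ∷ l) a b
  there : ∀ {a b x l} → Before l a b → Before (x ∷ l) a b

data Consecutive {A : Set} : List A → A → A → Set where
  here  : ∀ {a b l} → Consecutive (a ∷ b ∷ l) a b
  there : ∀ {a b x l} → Consecutive l a b → Consecutive (x ∷ l) a b

before-∈ˡ : ∀ {l : List A} {a b} → Before l a b → a ∈ l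
before-∈ˡ (here _)  = here refl
before-∈ˡ (there p) = there (before-∈ˡ p)

before-∈ʳ : ∀ {l : List A} {x a b} → Before (x ∷ l) a b → b ∈ l
before-∈ʳ (here b∈)          = b∈
before-∈ʳ (there p@(here _)) = there (before-∈ʳ p)
before-∈ʳ (there p@(there _)) = there (before-∈ʳ p)

consecutive⇒before : ∀ {l : List A} {a b} → Consecutive l a b → Before l a b
consecutive⇒before here      = here (here refl)
consecutive⇒before (there c) = there (consecutive⇒before c)

before-total : ∀ {l : List A} {a b} → a ∈ l → b ∈ l → a ≡ b ⊎ Before l a b ⊎ Before l b a
before-total (here refl) (here refl) = inj₁ refl
before-total (here refl) (there b∈)  = inj₂ (inj₁ (here b∈))
before-total (there a∈)  (here refl) = inj₂ (inj₂ (here a∈))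
before-total (there a∈)  (there b∈) with before-total a∈ b∈
... | inj₁ eq        = inj₁ eq
... | inj₂ (inj₁ p) = inj₂ (inj₁ (there p))
... | inj₂ (inj₂ p) = inj₂ (inj₂ (there p))

module _ {R : A → A → Set} where

  allPairs-before : ∀ {l a b} → AllPairs R l → Before l a b → R a b
  allPairs-before (ps ∷ _) (here b∈) = All.lookup ps b∈
  allPairs-before (_ ∷ q)  (there p) = allPairs-before q p

  before-allPairs : ∀ {l} → (∀ {a b} → Before l a b → R a b) → AllPairs R l
  before-allPairs {[]}    f = []
  before-allPairs {x ∷ l} f = All.tabulate (f ∘ here) ∷ before-allPairs (f ∘ there)

  module _ (asym : Asymmetric R) where

    asym⇒irrefl : ∀ {a} → ¬ R a a
    asym⇒irrefl r = asym r r

    -- Were the heads different, each would occur in the tail below the other, so each would precede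
    -- the other.
    sorted-heads : ∀ {x y l m} → All (R x) l → All (R y) m → x ∈ y ∷ m → y ∈ x ∷ l → x ≡ y
    sorted-heads ps qs (here eq)  _          = eq
    sorted-heads ps qs (there _)  (here eq)  = sym eq
    sorted-heads ps qs (there x∈) (there y∈) = ⊥-elim (asym (All.lookup qs x∈) (All.lookup ps y∈))

    sorted-unique : ∀ {l m} → AllPairs R l → AllPairs R m →
      (∀ {z} → z ∈ l → z ∈ m) → (∀ {z} → z ∈ m → z ∈ l) → l ≡ m
    sorted-unique {[]}    {[]}    _ _ f g = refl
    sorted-unique {[]}    {y ∷ m} _ _ f g with () ← g (here refl)
    sorted-unique {x ∷ l} {[]}    _ _ f g with () ← f (here refl)
    sorted-unique {x ∷ l} {y ∷ m} (ps ∷ p) (qs ∷ q) f g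
      with refl ← sorted-heads ps qs (f (here refl)) (g (here refl)) =
      cong (x ∷_) (sorted-unique p q
        (λ z∈ → tail (All.lookup ps z∈) (f (there z∈)))
        (λ z∈ → tail (All.lookup qs z∈) (g (there z∈))))
      where
      tail : ∀ {z k} → R x z → z ∈ x ∷ k → z ∈ k
      tail r (here refl) = ⊥-elim (asym⇒irrefl r)
      tail r (there z∈)  = z∈

    -- With `gap-consecutive` as its converse, this turns adjacency in a sorted list into the
    -- covering relation of `R`, so that descents can be studied through the order alone.
    consecutive-gap : ∀ {l a b z} → AllPairs R l → Consecutive l a b → z ∈ l → R a z → ¬ R z b
    consecutive-gap _ here (here refl) az zb = asym⇒irrefl az
    consecutive-gap _ here (there (here refl)) az zb = asym⇒irrefl zb
    consecutive-gap (_ ∷ qs ∷ _) here (there (there z∈)) az zb = asym zb (All.lookup qs z∈)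
    consecutive-gap (ps ∷ _) (there c) (here refl) az zb = asym az (All.lookup ps (before-∈ˡ (consecutive⇒before c)))
    consecutive-gap (_ ∷ q) (there c) (there z∈) az zb = consecutive-gap q c z∈ az zb

  gap-consecutive : ∀ {l a b} → AllPairs R l → Before l a b → (∀ {z} → R a z → ¬ R z b) → Consecutive l a b
  gap-consecutive (ps ∷ _) (here (here refl)) gap = here
  gap-consecutive ((az ∷ _) ∷ (qs ∷ _)) (here (there b∈)) gap = ⊥-elim (gap az (All.lookup qs b∈))
  gap-consecutive (_ ∷ q) (there p) gap = there (gap-consecutive q p gap)

-- Positions in vectors, and natural numbers as rationals

lookup-before : ∀ {k} (v : Vec A k) {i j} → toℕ i < toℕ j → Before (toList v) (lookup v i) (lookup v j)
lookup-before (x Vec.∷ v) {Fin.zero}  {Fin.suc j} _ = here (lookup-∈ v j)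
  where
  lookup-∈ : ∀ {k} (v : Vec A k) i → lookup v i ∈ toList v
  lookup-∈ (x Vec.∷ v) Fin.zero    = here refl
  lookup-∈ (x Vec.∷ v) (Fin.suc i) = there (lookup-∈ v i)
lookup-before (x Vec.∷ v) {Fin.suc i} {Fin.suc j} (s≤s lt) = there (lookup-before v lt)

lookup-index : ∀ {k} (v : Vec A k) {b} → b ∈ toList v → ∃ λ j → lookup v j ≡ b
lookup-index (x Vec.∷ v) (here refl) = Fin.zero , refl
lookup-index (x Vec.∷ v) (there b∈) with j , eq ← lookup-index v b∈ = Fin.suc j , eq

before-lookup : ∀ {k} (v : Vec A k) {a b} → Before (toList v) a b →
  ∃ λ i → ∃ λ j → toℕ i < toℕ j × lookup v i ≡ a × lookup v j ≡ b
before-lookup (x Vec.∷ v) (here b∈) with j , eq ← lookup-index v b∈ = Fin.zero , Fin.suc j , s≤s z≤n , refl , eq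
before-lookup (x Vec.∷ v) (there p) with i , j , lt , eq , eq′ ← before-lookup v p =
  Fin.suc i , Fin.suc j , s≤s lt , eq , eq′

-- The `0` is the denominator minus one. With denominator one throughout, comparing two values is
-- comparing their numerators.
fromℕ : ℕ → ℚ
fromℕ k = mkℚ (ℤ.+ k) 0 (Coprime.sym (Coprime.1-coprimeTo k))

fromℕ-mono-< : ∀ {j k} → j < k → fromℕ j ℚ.< fromℕ k
fromℕ-mono-< {j} {k} lt = ℚ.*<* (subst₂ ℤ._<_ (sym (ℤₚ.*-identityʳ (ℤ.+ j))) (sym (ℤₚ.*-identityʳ (ℤ.+ k))) (ℤ.+<+ lt))

fromℕ-cancel-< : ∀ {j k} → fromℕ j ℚ.≤ fromℕ k → ¬ k < j
fromℕ-cancel-< le lt = ℚₚ.<-irrefl refl (ℚₚ.<-≤-trans (fromℕ-mono-< lt) le)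

toList-surjective : ∀ {k} (l : List A) → length l ≡ k → ∃ λ (v : Vec A k) → toList v ≡ l
toList-surjective l refl = Vec.fromList l , Vecₚ.toList∘fromList l

sumℕ-ones : (f : A → ℕ) (xs : List A) → (∀ {x} → x ∈ xs → f x ≡ 1) → sumℕ (map f xs) ≡ length xs
sumℕ-ones f []       h = refl
sumℕ-ones f (x ∷ xs) h = cong₂ _+_ (h (here refl)) (sumℕ-ones f xs (h ∘ there))

-- The correspondence between linear extensions and flats

module TwoChains (P : FinPoset n) (P₁ P₂ : Subset n)
  (chain₁ : IsChain P P₁) (chain₂ : IsChain P P₂) (cover : P₁ ∪ P₂ ≡ ⊤) where

  open FinPoset P
  open IsDecStrictPartialOrder isDSPO using (irrefl; asym) renaming (trans to <P-trans)

  -- `P₁` and `P₂` may overlap. The two sides are therefore `P₁` and its complement, which partition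
  -- the poset and are both chains, the complement lying inside `P₂`.
  side : Fin n → Bool
  side a = ⌊ a ∈? P₁ ⌋

  side⇒∈P₂ : ∀ {a} → side a ≡ false → a ∈ₛ P₂
  side⇒∈P₂ {a} eq with a ∈? P₁
  ... | no a∉P₁ = [ (λ a∈ → contradiction a∈ a∉P₁) , (λ a∈ → a∈) ]′
                    (x∈p∪q⁻ P₁ P₂ (subst (a ∈ₛ_) (sym cover) ∈⊤))

  comparable : ∀ {a b} → side a ≡ side b → a ≢ b → a <P b ⊎ b <P a
  comparable {a} {b} eq a≢b with side a in eqa
  ... | true  = chain₁ a b (⌊⌋⁻ (a ∈? P₁) eqa) (⌊⌋⁻ (b ∈? P₁) (sym eq)) a≢b
  ... | false = chain₂ a b (side⇒∈P₂ eqa) (side⇒∈P₂ (sym eq)) a≢b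

  descent : Fin n → Fin n → Bool
  descent a b = ⌊ a ∈? P₂ ⌋ ∧ ⌊ b ∈? P₁ ⌋ ∧ incomparableᵇ P a b

  record Descent (a b : Fin n) : Set where
    constructor mkDescent
    field
      right : side a ≡ false
      left  : side b ≡ true
      a≮b   : ¬ a <P b
      b≮a   : ¬ b <P a
  open Descent

  descent⁺ : ∀ {a b} → Descent a b → descent a b ≡ true
  descent⁺ {a} {b} (mkDescent r l a≮b b≮a) =
    ∧⁺ (⌊⌋⁺ (a ∈? P₂) (side⇒∈P₂ r)) (∧⁺ l
      (∧⁺ (not⁺ (a≮b ∘ ⌊⌋⁻ (a <P? b))) (not⁺ (b≮a ∘ ⌊⌋⁻ (b <P? a)))))

  -- If `a` were in `P₁` as well as `P₂`, it would be comparable to `b`. The case `a ≡ b` has to be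
  -- excluded because `incomparableᵇ` holds of an element and itself.
  descent⁻ : ∀ {a b} → a ≢ b → descent a b ≡ true → Descent a b
  descent⁻ {a} {b} a≢b eq
    with p , eq′ ← ∧⁻ {⌊ a ∈? P₂ ⌋} eq with q , eq″ ← ∧⁻ {⌊ b ∈? P₁ ⌋} eq′ with r , s ← ∧⁻ {not ⌊ a <P? b ⌋} eq″ =
    mkDescent right′ q a≮b′ b≮a′
    where
    a≮b′ : ¬ a <P b
    a≮b′ = not⁻ r ∘ ⌊⌋⁺ (a <P? b)
    b≮a′ : ¬ b <P a
    b≮a′ = not⁻ s ∘ ⌊⌋⁺ (b <P? a)
    right′ : side a ≡ false
    right′ with side a in eqa
    ... | false = refl
    ... | true  = ⊥-elim ([ a≮b′ , b≮a′ ]′ (comparable (trans eqa (sym q)) a≢b))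

  -- Completeness of the list is left out, so that every tail satisfies the condition again and
  -- recursion on lists applies.
  LinExt : List (Fin n) → Set
  LinExt = AllPairs (λ a b → a ≢ b × ¬ b <P a)

  linExt-unique : ∀ {l} → LinExt l → Unique l
  linExt-unique = AllPairs.map proj₁

  -- The flat of a linear extension

  descentFlat : List (Fin n) → Mat n
  descentFlat (x ∷ y ∷ l) = if descent x y then merge x y (descentFlat (y ∷ l)) else descentFlat (y ∷ l)
  descentFlat _           = idRel

  DescentIn : List (Fin n) → Fin n → Fin n → Set
  DescentIn l a b = Consecutive l a b × descent a b ≡ true

  there′ : ∀ {x l a b} → DescentIn l a b → DescentIn (x ∷ l) a b
  there′ (c , d) = there c , d

  descentIn⇒Descent : ∀ {l a b} → LinExt l → DescentIn l a b → Descent a b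
  descentIn⇒Descent L (c , d) = descent⁻ (proj₁ (allPairs-before L (consecutive⇒before c))) d

  descentFlat-refl : ∀ l a → Rel (descentFlat l) a a
  descentFlat-refl []      a = idRel⁺ a
  descentFlat-refl (_ ∷ []) a = idRel⁺ a
  descentFlat-refl (x ∷ y ∷ l) a with descent x y | descentFlat-refl (y ∷ l) a
  ... | true  | r = merge⁺ (inj₁ r)
  ... | false | r = r

  descentFlat⁺ : ∀ {l a b} → DescentIn l a b → Rel (descentFlat l) a b × Rel (descentFlat l) b a
  descentFlat⁺ (here {a} {b} {l} , d) rewrite d =
    merge⁺ {X = descentFlat (b ∷ l)} (inj₂ fwd) , merge⁺ {X = descentFlat (b ∷ l)} (inj₂ bwd)
  descentFlat⁺ {l = x ∷ y ∷ l} (there c , d) with descent x y | descentFlat⁺ (c , d)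
  ... | true  | r , s = merge⁺ (inj₁ r) , merge⁺ (inj₁ s)
  ... | false | rs    = rs

  descentFlat⁻ : ∀ l {a b} → Rel (descentFlat l) a b → a ≡ b ⊎ DescentIn l a b ⊎ DescentIn l b a
  descentFlat⁻ []       r = inj₁ (idRel⁻ r)
  descentFlat⁻ (_ ∷ []) r = inj₁ (idRel⁻ r)
  descentFlat⁻ (x ∷ y ∷ l) {a} {b} r with descent x y in d | descentFlat⁻ (y ∷ l) {a} {b}
  ... | false | rec = Sum.map₂ (Sum.map there′ there′) (rec r)
  ... | true  | rec with merge⁻ {X = descentFlat (y ∷ l)} r
  ...   | inj₁ s   = Sum.map₂ (Sum.map there′ there′) (rec s)
  ...   | inj₂ fwd = inj₂ (inj₁ (here , d))
  ...   | inj₂ bwd = inj₂ (inj₂ (here , d))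

  module _ {x y l} (L : LinExt (x ∷ y ∷ l)) (d : descent x y ≡ true) where

    private
      x∉ : x ∉ y ∷ l
      x∉ = Unique.Unique[x∷xs]⇒x∉xs (linExt-unique L)
      x≢y : x ≢ y
      x≢y refl = x∉ (here refl)
      L′ : LinExt (y ∷ l)
      L′ = AllPairs.tail L

    isolated-fst : Isolated (descentFlat (y ∷ l)) x
    isolated-fst r with descentFlat⁻ (y ∷ l) r
    ... | inj₁ refl            = refl
    ... | inj₂ (inj₁ (c , _)) = ⊥-elim (x∉ (before-∈ˡ (consecutive⇒before c)))
    ... | inj₂ (inj₂ (c , _)) = ⊥-elim (x∉ (there (before-∈ʳ (consecutive⇒before c))))

    -- Descents do not overlap: `y` ends the descent from `x`, so it lies in `P₁` and cannot begin
    -- another one; and since it heads the remaining list, it cannot end another one there.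
    isolated-snd : Isolated (descentFlat (y ∷ l)) y
    isolated-snd r with descentFlat⁻ (y ∷ l) r
    ... | inj₁ refl      = refl
    ... | inj₂ (inj₁ p) with () ← trans (sym (left (descent⁻ x≢y d))) (right (descentIn⇒Descent L′ p))
    ... | inj₂ (inj₂ (c , _)) =
      ⊥-elim (Unique.Unique[x∷xs]⇒x∉xs (linExt-unique L′) (before-∈ʳ (consecutive⇒before c)))

  descentFlat-isEquiv : ∀ {l} → LinExt l → IsEquiv (descentFlat l)
  descentFlat-isEquiv {[]}     _ = idRel-isEquiv
  descentFlat-isEquiv {_ ∷ []} _ = idRel-isEquiv
  descentFlat-isEquiv {x ∷ y ∷ l} L@(_ ∷ L′) with descent x y in d
  ... | true  = merge-isEquiv (descentFlat-isEquiv L′) (isolated-fst L d) (isolated-snd L d)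
  ... | false = descentFlat-isEquiv L′

  descentFlat-codim : ∀ {l} → LinExt l → codim (descentFlat l) ≡ desL P P₁ P₂ l
  descentFlat-codim {[]}     _ = codim-id {n}
  descentFlat-codim {_ ∷ []} _ = codim-id {n}
  descentFlat-codim {x ∷ y ∷ l} L@(ps ∷ L′) with descent x y in d
  ... | true  = trans (codim-merge (proj₁ (All.head ps)) (descentFlat-isEquiv L′) (isolated-fst L d) (isolated-snd L d))
                      (cong suc (descentFlat-codim L′))
  ... | false = descentFlat-codim L′

  descentFlat-∣μ∣ : ∀ (μ : Mat n → ℤ) → IsMöbius μ → ∀ {l} → LinExt l → ℤ.∣ μ (descentFlat l) ∣ ≡ 1
  descentFlat-∣μ∣ μ M {[]}     _ = cong ℤ.∣_∣ (proj₁ M)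
  descentFlat-∣μ∣ μ M {_ ∷ []} _ = cong ℤ.∣_∣ (proj₁ M)
  descentFlat-∣μ∣ μ M {x ∷ y ∷ l} L@(ps ∷ L′) with descent x y in d
  ... | true  = trans (∣μ-merge∣ μ M (proj₁ (All.head ps)) (descentFlat-isEquiv L′) (isolated-fst L d) (isolated-snd L d))
                      (descentFlat-∣μ∣ μ M L′)
  ... | false = descentFlat-∣μ∣ μ M L′

  -- A point of the cone on the flat of a linear extension

  next : ℕ → Fin n → List (Fin n) → ℕ
  next k x []      = k
  next k x (y ∷ _) = if descent x y then k else suc k

  -- The level rises by one at each step of the list except across a descent, so glued entries share
  -- a coordinate. The value for an empty list is a default that complete lists never reach.
  height : ℕ → List (Fin n) → Fin n → ℕ
  height k []      z = k
  height k (x ∷ l) z = if ⌊ x Fin.≟ z ⌋ then k else height (next k x l) l z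

  ≤-next : ∀ k x l → k ≤ next k x l
  ≤-next k x []      = ℕₚ.≤-refl
  ≤-next k x (y ∷ l) with descent x y
  ... | true  = ℕₚ.≤-refl
  ... | false = ℕₚ.n≤1+n k

  ≤-height : ∀ k l z → k ≤ height k l z
  ≤-height k []      z = ℕₚ.≤-refl
  ≤-height k (x ∷ l) z with ⌊ x Fin.≟ z ⌋
  ... | true  = ℕₚ.≤-refl
  ... | false = ℕₚ.≤-trans (≤-next k x l) (≤-height (next k x l) l z)

  height-head : ∀ k x l → height k (x ∷ l) x ≡ k
  height-head k x l rewrite ⌊⌋⁺ (x Fin.≟ x) refl = refl

  height-tail : ∀ k {x} l {z} → x ≢ z → height k (x ∷ l) z ≡ height (next k x l) l z
  height-tail k {x} l {z} x≢z with x Fin.≟ z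
  ... | yes eq = ⊥-elim (x≢z eq)
  ... | no  _  = refl

  -- An entry of `P₁` cannot begin a descent, so the level rises immediately after it.
  height-left : ∀ k {x l z} → LinExt (x ∷ l) → z ∈ l → side x ≡ true → k < height k (x ∷ l) z
  height-left k {x} {l@(y ∷ l′)} {z} (ps ∷ L) z∈ s = subst (k <_) (sym (height-tail k l (proj₁ (All.lookup ps z∈)))) go
    where
    go : k < height (next k x l) l z
    go with descent x y in d
    ... | false = ≤-height (suc k) l z
    ... | true with () ← trans (sym s) (right (descent⁻ (proj₁ (All.head ps)) d))

  -- A level stretch consists of a single descent, whose first entry is outside `P₁` and
  -- incomparable to the second. The alternative `a <P b` puts the heights into the cone;
  -- `side a ≡ true` is what later excludes a hop from `b` back to `a`.
  height-before : ∀ k {l a b} → LinExt l → Before l a b → side a ≡ true ⊎ a <P b → height k l a < height k l b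
  height-before k {a ∷ l} {b = b} L (here b∈) (inj₁ s) =
    subst (_< height k (a ∷ l) b) (sym (height-head k a l)) (height-left k L b∈ s)
  height-before k {a ∷ l@(y ∷ l′)} {b = b} (ps ∷ L) (here b∈) (inj₂ a<b) =
    subst₂ _<_ (sym (height-head k a l)) (sym (height-tail k l (proj₁ (All.lookup ps b∈)))) (go b∈)
    where
    go : b ∈ l → k < height (next k a l) l b
    go b∈ with descent a y in d
    ... | false = ≤-height (suc k) l b
    go (here refl) | true = ⊥-elim (a≮b (descent⁻ (proj₁ (All.head ps)) d) a<b)
    -- The level stays from `a` to `y`, but `y` ends a descent and so lies in `P₁`; the rise comes
    -- right after it, at or before `b`.
    go (there b∈′) | true = height-left k L b∈′ (left (descent⁻ (proj₁ (All.head ps)) d))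
  height-before k {x ∷ l} (ps ∷ L) (there p) h =
    subst₂ _<_ (sym (height-tail k l (proj₁ (All.lookup ps (before-∈ˡ p)))))
               (sym (height-tail k l (proj₁ (All.lookup ps (before-∈ʳ (there {x = x} p))))))
      (height-before (next k x l) L p h)

  height-descent : ∀ k {l a b} → LinExt l → DescentIn l a b → height k l a ≡ height k l b
  height-descent k {a ∷ l@(b ∷ l′)} (ps ∷ L) (here , d) = begin
    height k (a ∷ l) a        ≡⟨ height-head k a l ⟩
    k                         ≡⟨ height-head k b l′ ⟨
    height k l b              ≡⟨ cong (λ t → height (if t then k else suc k) l b) d ⟨
    height (next k a l) l b   ≡⟨ height-tail k l (proj₁ (All.head ps)) ⟨
    height k (a ∷ l) b        ∎
    where open ≡-Reasoning
  height-descent k {x ∷ l} (ps ∷ L) (there c , d) =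
    trans (height-tail k l (proj₁ (All.lookup ps (before-∈ˡ (consecutive⇒before c)))))
    (trans (height-descent (next k x l) L (c , d))
    (sym (height-tail k l (proj₁ (All.lookup ps (before-∈ʳ (there {x = x} (consecutive⇒before c))))))))

  linExt-before : ∀ {l} → LinExt l → (∀ z → z ∈ l) → ∀ {a b} → a <P b → Before l a b
  linExt-before L all∈ {a} {b} a<b with before-total (all∈ a) (all∈ b)
  ... | inj₁ eq       = ⊥-elim (irrefl eq a<b)
  ... | inj₂ (inj₁ p) = p
  ... | inj₂ (inj₂ p) = ⊥-elim (proj₂ (allPairs-before L p) a<b)

  heightℚ : List (Fin n) → Fin n → ℚ
  heightℚ l = fromℕ ∘ height 0 l

  descentFlat-meetsCone : ∀ {l} → LinExt l → (∀ z → z ∈ l) → MeetsCone P (descentFlat l)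
  descentFlat-meetsCone {l} L all∈ = heightℚ l
    , (λ i j r → cong fromℕ (const-on (descentFlat⁻ l (related r))))
    , (λ i j i<j → fromℕ-mono-< (height-before 0 L (linExt-before L all∈ i<j) (inj₂ i<j)))
    where
    const-on : ∀ {i j} → i ≡ j ⊎ DescentIn l i j ⊎ DescentIn l j i → height 0 l i ≡ height 0 l j
    const-on (inj₁ eq)        = cong (height 0 l) eq
    const-on (inj₂ (inj₁ p)) = height-descent 0 L p
    const-on (inj₂ (inj₂ p)) = sym (height-descent 0 L p)

  -- The preorder of a flat and the sorting order

  true≢false : ∀ {b : Bool} → b ≡ true → b ≢ false
  true≢false refl ()

  _≤P_ : Fin n → Fin n → Set
  a ≤P b = a ≡ b ⊎ a <P b

  ≤P-trans : ∀ {a b c} → a ≤P b → b ≤P c → a ≤P c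
  ≤P-trans (inj₁ refl) b≤c         = b≤c
  ≤P-trans (inj₂ a<b)  (inj₁ refl) = inj₂ a<b
  ≤P-trans (inj₂ a<b)  (inj₂ b<c)  = inj₂ (<P-trans a<b b<c)

  -- When E meets the cone, one use of E suffices to generate the preorder ≤_E from P and E:
  -- two uses return to the original chain, where P decides.
  Hop : Mat n → Fin n → Fin n → Set
  Hop E a b = ∃₂ λ u v → a ≤P u × Rel E u v × v ≤P b

  hop? : ∀ E a b → Dec (Hop E a b)
  hop? E a b = Finₚ.any? λ u → Finₚ.any? λ v →
    (a ≤P? u) ×-dec rel? u v ×-dec (v ≤P? b)
    where
    _≤P?_ : ∀ a b → Dec (a ≤P b)
    a ≤P? b = (a Fin.≟ b) ⊎-dec (a <P? b)
    rel? : ∀ u v → Dec (Rel E u v)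
    rel? u v = Dec.map′ related rel≡true (rel E u v Bool.≟ true)

  <-hop : ∀ {E a b c} → a <P b → Hop E b c → Hop E a c
  <-hop a<b (u , v , b≤u , r , v≤c) = u , v , ≤P-trans (inj₂ a<b) b≤u , r , v≤c

  hop-< : ∀ {E a b c} → Hop E a b → b <P c → Hop E a c
  hop-< (u , v , a≤u , r , v≤b) b<c = u , v , a≤u , r , ≤P-trans v≤b (inj₂ b<c)

  data _⊢_≺_ (E : Mat n) (a b : Fin n) : Set where
    same : side a ≡ side b → a <P b → E ⊢ a ≺ b
    jump : side a ≡ false → side b ≡ true → Hop E a b → E ⊢ a ≺ b
    stay : side a ≡ true → side b ≡ false → ¬ Hop E b a → E ⊢ a ≺ b

  module _ {E : Mat n} where

    ≺-asym : ∀ {a b} → E ⊢ a ≺ b → ¬ E ⊢ b ≺ a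
    ≺-asym (same _ a<b)  (same _ b<a)   = asym a<b b<a
    ≺-asym (same s _)    (jump r l _)   = true≢false l (trans s r)
    ≺-asym (same s _)    (stay l r _)   = true≢false (trans s l) r
    ≺-asym (jump r l _)  (same s _)     = true≢false l (trans s r)
    ≺-asym (jump r _ _)  (jump _ l _)   = true≢false l r
    ≺-asym (jump _ _ h)  (stay _ _ ¬h)  = ¬h h
    ≺-asym (stay l r _)  (same s _)     = true≢false l (trans (sym s) r)
    ≺-asym (stay _ _ ¬h) (jump _ _ h)   = ¬h h
    ≺-asym (stay l _ _)  (stay _ r _)   = true≢false l r

    -- In the two mixed cases the path crosses to the other chain and returns, so `a` and `c` lie on
    -- one chain. If `c ≤P a`, the hop given by one step would extend to the hop that the other step
    -- forbids; hence `a <P c`.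
    ≺-trans : ∀ {a b c} → E ⊢ a ≺ b → E ⊢ b ≺ c → E ⊢ a ≺ c
    ≺-trans (same s a<b) (same s′ b<c) = same (trans s s′) (<P-trans a<b b<c)
    ≺-trans (same s a<b) (jump r l h)  = jump (trans s r) l (<-hop a<b h)
    ≺-trans (same s a<b) (stay l r ¬h) = stay (trans s l) r (λ h → ¬h (hop-< h a<b))
    ≺-trans (jump r l h) (same s b<c)  = jump r (trans (sym s) l) (hop-< h b<c)
    ≺-trans (jump _ l _) (jump r _ _)  = ⊥-elim (true≢false l r)
    ≺-trans {a} {c = c} (jump r l h) (stay l′ r′ ¬h) = same (trans r (sym r′)) a<c
      where
      a<c : a <P c
      a<c with a Fin.≟ c
      ... | yes refl = ⊥-elim (¬h h)
      ... | no a≢c   = [ (λ p → p) , (λ c<a → ⊥-elim (¬h (<-hop c<a h))) ]′ (comparable (trans r (sym r′)) a≢c)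
    ≺-trans (stay l r ¬h) (same s b<c) = stay l (trans (sym s) r) (λ h → ¬h (<-hop b<c h))
    ≺-trans {a} {c = c} (stay l r ¬h) (jump r′ l′ h) = same (trans l (sym l′)) a<c
      where
      a<c : a <P c
      a<c with a Fin.≟ c
      ... | yes refl = ⊥-elim (¬h h)
      ... | no a≢c   = [ (λ p → p) , (λ c<a → ⊥-elim (¬h (hop-< h c<a))) ]′ (comparable (trans l (sym l′)) a≢c)
    ≺-trans (stay _ r _) (stay l _ _) = ⊥-elim (true≢false l r)

    ≺-total : ∀ {a b} → a ≢ b → E ⊢ a ≺ b ⊎ E ⊢ b ≺ a
    ≺-total {a} {b} a≢b with side a in sa | side b in sb
    ... | true  | true  = Sum.map (same (trans sa (sym sb))) (same (trans sb (sym sa))) (comparable (trans sa (sym sb)) a≢b)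
    ... | false | false = Sum.map (same (trans sa (sym sb))) (same (trans sb (sym sa))) (comparable (trans sa (sym sb)) a≢b)
    ... | false | true with hop? E a b
    ...   | yes h = inj₁ (jump sa sb h)
    ...   | no ¬h = inj₂ (stay sb sa ¬h)
    ≺-total {a} {b} a≢b | true | false with hop? E b a
    ...   | yes h = inj₂ (jump sb sa h)
    ...   | no ¬h = inj₁ (stay sa sb ¬h)

    ≺-compare : Trichotomous _≡_ (E ⊢_≺_)
    ≺-compare a b with a Fin.≟ b
    ... | yes refl = tri≈ (λ p → ≺-asym p p) refl (λ p → ≺-asym p p)
    ... | no a≢b with ≺-total a≢b
    ...   | inj₁ p = tri< p a≢b (≺-asym p)
    ...   | inj₂ p = tri> (≺-asym p) a≢b p

    ≺-isStrictTotalOrder : IsStrictTotalOrder _≡_ (E ⊢_≺_)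
    ≺-isStrictTotalOrder = record
      { isStrictPartialOrder = record
        { isEquivalence = isEquivalence
        ; irrefl        = λ { refl p → ≺-asym p p }
        ; trans         = ≺-trans
        ; <-resp-≈      = (λ { refl p → p }) , (λ { refl p → p })
        }
      ; compare = ≺-compare
      }

    ∃-sorted : ∃ λ l → AllPairs (E ⊢_≺_) l × l ↭ allFin n
    ∃-sorted = l , strict , sort-↭ (allFin n)
      where
      open ToNonStrict _≡_ (E ⊢_≺_) using (isDecTotalOrder)
      order : DecTotalOrder _ _ _
      order = record { isDecTotalOrder = isDecTotalOrder ≺-isStrictTotalOrder }
      open Sort order using (sort; sort-↭; sort-↗)
      l : List (Fin n)
      l = sort (allFin n)
      distinct : Unique l
      distinct = Permₛ.AllPairs-resp-↭ (setoid (Fin n)) ≢-sym (resp₂ _≢_)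
        (Perm.↭⇒↭ₛ (Perm.↭-sym (sort-↭ (allFin n)))) (Unique.allFin⁺ n)
      -- Sorting yields only the reflexive closure of the order; distinctness of the entries makes
      -- it strict.
      strict : AllPairs (E ⊢_≺_) l
      strict = AllPairs.map (λ { (inj₁ p , _) → p ; (inj₂ eq , a≢b) → ⊥-elim (a≢b eq) })
        (AllPairs.zip (Sorted⇒AllPairs (DecTotalOrder.totalOrder order) (sort-↗ (allFin n)) , distinct))

  -- Linear extensions are sorted for their own flats

  module _ {E : Mat n} (meets : MeetsCone P E) where

    private
      x : Fin n → ℚ
      x = proj₁ meets
      x-const : ∀ {a b} → Rel E a b → x a ≡ x b
      x-const (related r) = proj₁ (proj₂ meets) _ _ r
      x-mono : ∀ {a b} → a ≤P b → x a ℚ.≤ x b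
      x-mono (inj₁ refl) = ℚₚ.≤-refl
      x-mono (inj₂ a<b)  = ℚₚ.<⇒≤ (proj₂ (proj₂ meets) _ _ a<b)

    hop-≤ : ∀ {a b} → Hop E a b → x a ℚ.≤ x b
    hop-≤ (u , v , a≤u , r , v≤b) =
      ℚₚ.≤-trans (x-mono a≤u) (ℚₚ.≤-trans (ℚₚ.≤-reflexive (x-const r)) (x-mono v≤b))

    ≤⇒≯ : ∀ {a b} → x a ℚ.≤ x b → ¬ b <P a
    ≤⇒≯ a≤b b<a = ℚₚ.<-irrefl refl (ℚₚ.<-≤-trans (proj₂ (proj₂ meets) _ _ b<a) a≤b)

    hop⇒≯ : ∀ {a b} → Hop E a b → ¬ b <P a
    hop⇒≯ = ≤⇒≯ ∘ hop-≤

    hop-related⇒≯ : ∀ {a b c} → Hop E a b → Rel E b c → ¬ c <P a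
    hop-related⇒≯ h r = ≤⇒≯ (ℚₚ.≤-trans (hop-≤ h) (ℚₚ.≤-reflexive (x-const r)))

    related-hop⇒≯ : ∀ {a b c} → Rel E a b → Hop E b c → ¬ c <P a
    related-hop⇒≯ r h = ≤⇒≯ (ℚₚ.≤-trans (ℚₚ.≤-reflexive (x-const r)) (hop-≤ h))

  -- Up to the first entry `z` of `P₁` after `a`, the list climbs a single chain. The entry just
  -- before `z` is either below `z` or forms a descent with it, which `E` glues; from `z` onwards
  -- `b` is reached inside `P₁`. So one use of `E` is enough.
  walk : ∀ {E l a b} → (∀ c → Rel E c c) → LinExt l → (∀ {u v} → DescentIn l u v → Rel E u v) →
    Before l a b → side a ≡ false → side b ≡ true → Hop E a b
  walk {l = _ ∷ _} E-refl (_ ∷ L) E-desc (there p) r s = walk E-refl L (E-desc ∘ there′) p r s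
  walk {E} {l = a ∷ z ∷ l} {b = b} E-refl (ps ∷ L′@(qs ∷ _)) E-desc (here b∈) r s
    with side z in sz | walk {E} {z ∷ l} {z} {b} E-refl L′ (E-desc ∘ there′)
  ... | true  | _   = via (a <P? z)
    where
    z≤b : ∀ {b} → b ∈ z ∷ l → side b ≡ true → z ≤P b
    z≤b (here refl) _ = inj₁ refl
    z≤b (there b∈)  s with z≢b , b≮z ← All.lookup qs b∈ =
      [ inj₂ , (λ b<z → ⊥-elim (b≮z b<z)) ]′ (comparable (trans sz (sym s)) z≢b)
    via : Dec (a <P z) → Hop E a b
    via (yes a<z) = z , z , inj₂ a<z , E-refl z , z≤b b∈ s
    via (no a≮z)  = a , z , inj₁ refl ,
      E-desc (here , descent⁺ (mkDescent r sz a≮z (proj₂ (All.head ps)))) , z≤b b∈ s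
  ... | false | rec = further b∈
    where
    further : b ∈ z ∷ l → Hop E a b
    further (here refl) = ⊥-elim (true≢false s sz)
    further (there b∈)  =
      [ (λ a<z → <-hop a<z (rec (here b∈) refl s))
      , (λ z<a → ⊥-elim (proj₂ (All.head ps) z<a)) ]′ (comparable (trans r (sym sz)) (proj₁ (All.head ps)))

  descentFlat-sorted : ∀ {l} → LinExt l → (∀ z → z ∈ l) → AllPairs (descentFlat l ⊢_≺_) l
  descentFlat-sorted {l} L all∈ = before-allPairs precedes
    where
    E : Mat n
    E = descentFlat l
    precedes : ∀ {a b} → Before l a b → E ⊢ a ≺ b
    precedes {a} {b} p with a≢b , b≮a ← allPairs-before L p with side a in sa | side b in sb
    ... | false | true  = jump sa sb (walk (descentFlat-refl l) L (proj₁ ∘ descentFlat⁺) p sa sb)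
    -- A hop from `b` back to `a` would force the height of `b` to be at most that of `a`, but the
    -- height rises after the entry `a` of `P₁`.
    ... | true  | false = stay sa sb λ h →
      fromℕ-cancel-< (hop-≤ (descentFlat-meetsCone L all∈) h) (height-before 0 L p (inj₁ sa))
    ... | true  | true  = same (trans sa (sym sb))
      ([ (λ a<b → a<b) , (λ b<a → ⊥-elim (b≮a b<a)) ]′ (comparable (trans sa (sym sb)) a≢b))
    ... | false | false = same (trans sa (sym sb))
      ([ (λ a<b → a<b) , (λ b<a → ⊥-elim (b≮a b<a)) ]′ (comparable (trans sa (sym sb)) a≢b))

  descentFlat-injective : ∀ {l m} → LinExt l → LinExt m → (∀ z → z ∈ l) → (∀ z → z ∈ m) →
    descentFlat l ≡ descentFlat m → l ≡ m
  descentFlat-injective {l} {m} L M all∈l all∈m eq =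
    sorted-unique ≺-asym (descentFlat-sorted L all∈l)
      (subst (λ E → AllPairs (E ⊢_≺_) m) (sym eq) (descentFlat-sorted M all∈m))
      (λ _ → all∈m _) (λ _ → all∈l _)

  -- Sorting by a flat that meets the cone

  module _ {E : Mat n} (e : IsEquiv E) (meets : MeetsCone P E) where

    private
      step : ∀ {a b} → Rel E a b → Hop E a b
      step r = _ , _ , inj₁ refl , r , inj₁ refl

    <P⇒≺ : ∀ {a b} → a <P b → E ⊢ a ≺ b
    <P⇒≺ {a} {b} a<b with side a in sa | side b in sb
    ... | true  | true  = same (trans sa (sym sb)) a<b
    ... | false | false = same (trans sa (sym sb)) a<b
    ... | false | true  = jump sa sb (<-hop a<b (step (≈-refl e b)))
    ... | true  | false = stay sa sb (λ h → hop⇒≯ meets h a<b)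

    -- Comparable elements have different coordinates at a point of the cone, related ones equal
    -- coordinates. A block thus meets each side at most once, which is why no block has more than
    -- two elements.
    related-same-side : ∀ {a b} → Rel E a b → side a ≡ side b → a ≡ b
    related-same-side {a} {b} r s with a Fin.≟ b
    ... | yes eq = eq
    ... | no a≢b = ⊥-elim ([ hop⇒≯ meets (step (≈-sym e r)) , hop⇒≯ meets (step r) ]′ (comparable s a≢b))

    module _ {l} (sorted : AllPairs (E ⊢_≺_) l) (all∈ : ∀ z → z ∈ l) where

      sorted-linExt : LinExt l
      sorted-linExt = AllPairs.map (λ p → (λ { refl → ≺-asym p p }) , (λ b<a → ≺-asym p (<P⇒≺ b<a))) sorted

      -- The elements `a` and `b` have the same coordinate at a point of the cone. An entry `z`
      -- between them would be strictly above `a` on its chain while hopping to `b`, or strictly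
      -- below `b` on its chain while reached by a hop from `a`; either way the coordinate of `z`
      -- contradicts the equality.
      related⇒descentIn : ∀ {a b} → Rel E a b → side a ≡ false → side b ≡ true → DescentIn l a b
      related⇒descentIn {a} {b} r sa sb =
        gap-consecutive sorted a-before-b gap ,
        descent⁺ (mkDescent sa sb (hop⇒≯ meets (step (≈-sym e r))) (hop⇒≯ meets (step r)))
        where
        a-before-b : Before l a b
        a-before-b with before-total (all∈ a) (all∈ b)
        ... | inj₁ refl     = ⊥-elim (true≢false sb sa)
        ... | inj₂ (inj₁ p) = p
        ... | inj₂ (inj₂ p) = ⊥-elim (≺-asym (jump sa sb (step r)) (allPairs-before sorted p))
        gap : ∀ {z} → E ⊢ a ≺ z → ¬ E ⊢ z ≺ b
        gap (same s a<z)  (same s′ _)   = true≢false sb (trans (sym (trans s s′)) sa)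
        gap (same s a<z)  (jump _ _ h)  = hop-related⇒≯ meets h (≈-sym e r) a<z
        gap (same s a<z)  (stay l _ _)  = true≢false l (trans (sym s) sa)
        gap (jump _ _ h)  (same s z<b)  = related-hop⇒≯ meets (≈-sym e r) h z<b
        gap (jump _ l _)  (jump r _ _)  = true≢false l r
        gap (jump _ _ _)  (stay _ r _)  = true≢false sb r
        gap (stay l _ _)  _             = true≢false l sa

      -- In the sorted list `a` precedes `b` because of a hop. Adjacency forces that hop to be a
      -- bare use of `E`: a proper `<P` step at either end would produce an entry strictly between
      -- the two.
      descentIn⇒related : ∀ {a b} → DescentIn l a b → Rel E a b
      descentIn⇒related {a} {b} p@(c , _) = hop-related (allPairs-before sorted (consecutive⇒before c))
        where
        D : Descent a b
        D = descentIn⇒Descent sorted-linExt p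
        ≰ : ¬ a ≤P b
        ≰ (inj₁ refl) = true≢false (left D) (right D)
        ≰ (inj₂ a<b)  = a≮b D a<b
        between : ∀ {z} → E ⊢ a ≺ z → ¬ E ⊢ z ≺ b
        between = consecutive-gap ≺-asym sorted c (all∈ _)
        via : ∀ {u v} → a ≤P u → Rel E u v → v ≤P b → Rel E a b
        via {u} {v} a≤u r v≤b with side u in su | side v in sv
        ... | true  | true  with refl ← related-same-side r (trans su (sym sv)) = ⊥-elim (≰ (≤P-trans a≤u v≤b))
        ... | false | false with refl ← related-same-side r (trans su (sym sv)) = ⊥-elim (≰ (≤P-trans a≤u v≤b))
        -- Here the hop crosses in the wrong direction, so `v` lies on the chain of `a`. Either
        -- `a ≤P v`, which makes `a` and `b` comparable, or `v <P a`, against the hop from `a` to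
        -- `v`.
        via {u} {v} a≤u r v≤b | true | false with a Fin.≟ v
        ... | yes refl = ⊥-elim (≰ v≤b)
        ... | no a≢v = ⊥-elim ([ (λ a<v → ≰ (≤P-trans (inj₂ a<v) v≤b))
                               , (λ v<a → hop⇒≯ meets (u , v , a≤u , r , inj₁ refl) v<a) ]′
                                 (comparable (trans (right D) (sym sv)) a≢v))
        via (inj₁ refl) r (inj₁ refl) | false | true = r
        via (inj₁ refl) r (inj₂ v<b)  | false | true = ⊥-elim (between (jump su sv (step r)) (<P⇒≺ v<b))
        via (inj₂ a<u)  r (inj₁ refl) | false | true = ⊥-elim (between (<P⇒≺ a<u) (jump su sv (step r)))
        via (inj₂ a<u)  r (inj₂ v<b)  | false | true =
          ⊥-elim (between (<P⇒≺ a<u) (≺-trans (jump su sv (step r)) (<P⇒≺ v<b)))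
        hop-related : E ⊢ a ≺ b → Rel E a b
        hop-related (same s _)                      = ⊥-elim (true≢false (left D) (trans (sym s) (right D)))
        hop-related (stay s _ _)                    = ⊥-elim (true≢false s (right D))
        hop-related (jump _ _ (_ , _ , p , r , q)) = via p r q

      descentFlat-sorted≡ : descentFlat l ≡ E
      descentFlat-sorted≡ = mat-ext (λ a b → f ∘ descentFlat⁻ l) g
        where
        f : ∀ {a b} → a ≡ b ⊎ DescentIn l a b ⊎ DescentIn l b a → Rel E a b
        f (inj₁ refl)      = ≈-refl e _
        f (inj₂ (inj₁ p)) = descentIn⇒related p
        f (inj₂ (inj₂ p)) = ≈-sym e (descentIn⇒related p)
        g : ∀ a b → Rel E a b → Rel (descentFlat l) a b
        g a b r with side a in sa | side b in sb
        ... | false | true  = proj₁ (descentFlat⁺ (related⇒descentIn r sa sb))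
        ... | true  | false = proj₂ (descentFlat⁺ (related⇒descentIn (≈-sym e r) sb sa))
        ... | true  | true  with refl ← related-same-side r (trans sa (sym sb)) = descentFlat-refl l a
        ... | false | false with refl ← related-same-side r (trans sa (sym sb)) = descentFlat-refl l a

    descentFlat-surjective : ∃ λ l → LinExt l × (∀ z → z ∈ l) × length l ≡ n × descentFlat l ≡ E
    descentFlat-surjective with l , sorted , l↭ ← ∃-sorted {E} =
      l , sorted-linExt sorted all∈ , all∈ , trans (↭-length l↭) (length-tabulate id)
        , descentFlat-sorted≡ sorted all∈
      where
      all∈ : ∀ z → z ∈ l
      all∈ z = ∈-resp-↭ (Perm.↭-sym l↭) (∈-allFin z)

  -- The Boolean test for linear extensions

  linExtᵇ⁻ : ∀ {σ} → isLinExtᵇ P σ ≡ true → LinExt (toList σ)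
  linExtᵇ⁻ {σ} p = before-allPairs λ q → ok (before-lookup σ q)
    where
    ok : ∀ {a b} → (∃₂ λ i j → toℕ i < toℕ j × lookup σ i ≡ a × lookup σ j ≡ b) → a ≢ b × ¬ b <P a
    ok (i , j , i<j , refl , refl) = distinct , ordered
      where
      cond : ∀ i j → (⌊ i Fin.≟ j ⌋ ∨ not ⌊ lookup σ i Fin.≟ lookup σ j ⌋)
        ∧ (not ⌊ lookup σ i <P? lookup σ j ⌋ ∨ (toℕ i <ᵇ toℕ j)) ≡ true
      cond i j = ∀Fin⁻ _ (∀Fin⁻ _ p i) j
      distinct : lookup σ i ≢ lookup σ j
      distinct eq with ∨⁻ {⌊ i Fin.≟ j ⌋} (proj₁ (∧⁻ (cond i j)))
      ... | inj₁ q = ℕₚ.<-irrefl (cong toℕ (⌊⌋⁻ (i Fin.≟ j) q)) i<j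
      ... | inj₂ q = not⁻ q (⌊⌋⁺ (lookup σ i Fin.≟ lookup σ j) eq)
      ordered : ¬ lookup σ j <P lookup σ i
      ordered lt = ℕₚ.<-asym i<j (ℕₚ.<ᵇ⇒< _ _ (from T-≡
        (⇒⁻ (proj₂ (∧⁻ {⌊ j Fin.≟ i ⌋ ∨ not ⌊ lookup σ j Fin.≟ lookup σ i ⌋} (cond j i)))
            (⌊⌋⁺ (lookup σ j <P? lookup σ i) lt))))

  linExtᵇ⁺ : ∀ {σ} → LinExt (toList σ) → isLinExtᵇ P σ ≡ true
  linExtᵇ⁺ {σ} L = ∀Fin⁺ _ λ i → ∀Fin⁺ _ λ j → ∧⁺ (∨⁺ (distinct i j)) (⇒⁺ (ordered i j ∘ ⌊⌋⁻ (_ <P? _)))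
    where
    order : ∀ {i j} → toℕ i < toℕ j → lookup σ i ≢ lookup σ j × ¬ lookup σ j <P lookup σ i
    order i<j = allPairs-before L (lookup-before σ i<j)
    distinct : ∀ i j → ⌊ i Fin.≟ j ⌋ ≡ true ⊎ not ⌊ lookup σ i Fin.≟ lookup σ j ⌋ ≡ true
    distinct i j with Finₚ.<-cmp i j
    ... | tri≈ _ eq _  = inj₁ (⌊⌋⁺ (i Fin.≟ j) eq)
    ... | tri< i<j _ _ = inj₂ (not⁺ (proj₁ (order i<j) ∘ ⌊⌋⁻ (lookup σ i Fin.≟ lookup σ j)))
    ... | tri> _ _ j<i = inj₂ (not⁺ (proj₁ (order j<i) ∘ sym ∘ ⌊⌋⁻ (lookup σ i Fin.≟ lookup σ j)))
    ordered : ∀ i j → lookup σ i <P lookup σ j → (toℕ i <ᵇ toℕ j) ≡ true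
    ordered i j lt with Finₚ.<-cmp i j
    ... | tri≈ _ eq _  = ⊥-elim (irrefl (cong (lookup σ) eq) lt)
    ... | tri< i<j _ _ = to T-≡ (ℕₚ.<⇒<ᵇ i<j)
    ... | tri> _ _ j<i = ⊥-elim (proj₂ (order j<i) lt)

  -- Pigeonhole: a missing `z` could be prepended to give `suc n` distinct elements of `Fin n`.
  linExt-complete : ∀ {l} → LinExt l → length l ≡ n → ∀ z → z ∈ l
  linExt-complete {l} L len z with DecMembership._∈?_ Fin._≟_ z l
  ... | yes z∈ = z∈
  ... | no z∉  = ⊥-elim (ℕₚ.<-irrefl (trans len (sym (length-tabulate {n = n} id)))
                   (unique-⊆-length (¬Any⇒All¬ _ z∉ ∷ linExt-unique L) (λ _ → ∈-allFin _)))

  linExtVec-complete : ∀ {σ : Vec (Fin n) n} → LinExt (toList σ) → ∀ z → z ∈ toList σ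
  linExtVec-complete {σ} L = linExt-complete L (Vecₚ.length-toList σ)

  -- Equality of the coefficients

  module _ (μ : Mat n → ℤ) (μ-isMöbius : IsMöbius μ) (meets? : ∀ E → Dec (MeetsCone P E)) (k : ℕ) where

    private
      isFlatᵇ : Mat n → Bool
      isFlatᵇ X = ⌊ meets? X ⌋ ∧ (codim X ≡ᵇ k)
      flatsₖ : List (Mat n)
      flatsₖ = filterᵇ isFlatᵇ (flats n)
      hasDesᵇ : Vec (Fin n) n → Bool
      hasDesᵇ σ = des P P₁ P₂ σ ≡ᵇ k
      linExtsₖ : List (Vec (Fin n) n)
      linExtsₖ = filterᵇ hasDesᵇ (linExts P)
      toFlat : Vec (Fin n) n → Mat n
      toFlat σ = descentFlat (toList σ)

    ∈-linExtsₖ⁻ : ∀ {σ} → σ ∈ linExtsₖ → LinExt (toList σ) × hasDesᵇ σ ≡ true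
    ∈-linExtsₖ⁻ σ∈ with p , q ← ∈-filterᵇ⁻ hasDesᵇ {xs = linExts P} σ∈ =
      linExtᵇ⁻ (proj₂ (∈-filterᵇ⁻ (isLinExtᵇ P) {xs = allVecs (allFin n) n} p)) , q

    ∈-flatsₖ⁻ : ∀ {X} → X ∈ flatsₖ → IsEquiv X × MeetsCone P X × (codim X ≡ᵇ k) ≡ true
    ∈-flatsₖ⁻ {X} X∈ with p , q ← ∈-filterᵇ⁻ isFlatᵇ {xs = flats n} X∈
      with m , c ← ∧⁻ {⌊ meets? X ⌋} q =
      ∈-flats⁻ p , ⌊⌋⁻ (meets? X) m , c

    preimage : ∀ {X} → X ∈ flatsₖ → ∃ λ σ → LinExt (toList σ) × toFlat σ ≡ X
    preimage X∈ with e , m , _ ← ∈-flatsₖ⁻ X∈ with l , L , _ , len , eq ← descentFlat-surjective e m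
      with σ , refl ← toList-surjective l len = σ , L , eq

    linExts↭flats : map toFlat linExtsₖ ↭ flatsₖ
    linExts↭flats = unique-↭
      (unique-map toFlat injective
        (unique-filterᵇ _ (unique-filterᵇ _ (unique-allVecs (Unique.allFin⁺ n) n))))
      (unique-filterᵇ _ (unique-flats n)) f g
      where
      injective : ∀ {σ τ} → σ ∈ linExtsₖ → τ ∈ linExtsₖ → toFlat σ ≡ toFlat τ → σ ≡ τ
      injective {σ} {τ} σ∈ τ∈ eq with L , _ ← ∈-linExtsₖ⁻ σ∈ with M , _ ← ∈-linExtsₖ⁻ τ∈ =
        trans (sym (Vecₚ.cast-is-id refl σ)) (Vecₚ.toList-injective refl σ τ
          (descentFlat-injective L M (linExtVec-complete L) (linExtVec-complete M) eq))
      f : ∀ {X} → X ∈ map toFlat linExtsₖ → X ∈ flatsₖ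
      f X∈ with σ , σ∈ , refl ← ∈-map⁻ toFlat X∈ with L , d ← ∈-linExtsₖ⁻ σ∈ =
        ∈-filterᵇ⁺ isFlatᵇ (∈-flats (descentFlat-isEquiv L))
          (∧⁺ (⌊⌋⁺ (meets? (toFlat σ)) (descentFlat-meetsCone L (linExtVec-complete L)))
              (trans (cong (_≡ᵇ k) (descentFlat-codim L)) d))
      g : ∀ {X} → X ∈ flatsₖ → X ∈ map toFlat linExtsₖ
      g X∈ with σ , L , refl ← preimage X∈ with _ , _ , c ← ∈-flatsₖ⁻ X∈ =
        ∈-map⁺ toFlat (∈-filterᵇ⁺ hasDesᵇ
          (∈-filterᵇ⁺ (isLinExtᵇ P) (∈-allVecs ∈-allFin σ) (linExtᵇ⁺ L))
          (trans (cong (_≡ᵇ k) (sym (descentFlat-codim L))) c))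

    poinCoeff≡desCoeff : poinCoeff P μ meets? k ≡ desCoeff P P₁ P₂ k
    poinCoeff≡desCoeff = begin
      sumℕ (map (λ X → ℤ.∣ μ X ∣) flatsₖ)  ≡⟨ sumℕ-ones _ flatsₖ ∣μ∣≡1 ⟩
      length flatsₖ                        ≡⟨ ↭-length linExts↭flats ⟨
      length (map toFlat linExtsₖ)         ≡⟨ length-map toFlat linExtsₖ ⟩
      length linExtsₖ                      ∎
      where
      open ≡-Reasoning
      ∣μ∣≡1 : ∀ {X} → X ∈ flatsₖ → ℤ.∣ μ X ∣ ≡ 1
      ∣μ∣≡1 X∈ with σ , L , refl ← preimage X∈ = descentFlat-∣μ∣ μ μ-isMöbius L

theorem1p5 : {n : ℕ} (P : FinPoset n) (P₁ P₂ : Subset n)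
    → Width P 2
    → IsChain P P₁ → IsChain P P₂ → P₁ ∪ P₂ ≡ ⊤
    → (μ : Mat n → ℤ) → IsMöbius μ
    → (meets? : (E : Mat n) → Dec (MeetsCone P E))
    → (k : ℕ) → poinCoeff P μ meets? k ≡ desCoeff P P₁ P₂ k
theorem1p5 P P₁ P₂ _ chain₁ chain₂ cover =
  TwoChains.poinCoeff≡desCoeff P P₁ P₂ chain₁ chain₂ cover
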